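{- (1) For every finite tree $T$ (with at least $4$ vertices), $\textit{VR}(T,2)> \frac 13$. (2) For every $\varepsilon>0$ and every integer $t\ge 2$, there is a finite tree $T$ with $\textit{VR}(T,t)< \frac 13+\varepsilon$.
   Context: The discrete Voronoi game on a finite graph $G$ with $t$ rounds: two players $\mathbf{A}$ and $\mathbf{B}$ alternately claim vertices of $G$, $\mathbf{A}$ first, each player claiming one vertex per round, for $t$ rounds (no vertex may be claimed twice; $G$ has at least $2t$ vertices). Distances are shortest-path distances in $G$. At the end, each vertex strictly closer to the set of $\mathbf{A}$'s claimed vertices than to the set of $\mathbf{B}$'s claimed vertices belongs to $\mathbf{A}$, each vertex strictly closer to $\mathbf{B}$'s set belongs to $\mathbf{B}$, and each vertex at equal distance is tied (each player receives half of it). The Voronoi ratio $\textit{VR}(G,t)$ is the number of vertices belonging to $\mathbf{A}$ plus half the number of tied vertices, divided by $|V(G)|$, when both players play optimally ($\mathbf{A}$ maximizing, $\mathbf{B}$ minimizing). -}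

module Defs where

open import Data.Nat using (ℕ; zero; suc; _+_; _*_; _<ᵇ_; _≡ᵇ_; _⊔_; _⊓_)
open import Data.Bool using (Bool; true; false; _∧_; _∨_; not; if_then_else_)
open import Data.Fin using (Fin; _≟_)
open import Data.List using (List; []; _∷_; _++_; length; map; foldr; filter; allFin)
open import Data.Bool.ListAction using (any)
open import Data.Nat.ListAction using (sum)
open import Data.List.Relation.Unary.Unique.Propositional using (Unique)
open import Data.List.Relation.Unary.Linked using (Linked)
open import Data.Integer using (+_)
open import Data.Rational using (ℚ; _/_)
open import Relation.Binary.PropositionalEquality using (_≡_)
open import Relation.Nullary.Decidable using (⌊_⌋)
open import Data.Product using (Σ; _×_)
open import Data.Empty using (⊥)
open import Relation.Nullary using (¬_)

record Graph (n : ℕ) : Set where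
  field
    adj     : Fin n → Fin n → Bool
    adj-sym : ∀ u v → adj u v ≡ adj v u
    irrefl  : ∀ v → adj v v ≡ false

module _ {n : ℕ} (G : Graph n) where
  open Graph G

  Adj : Fin n → Fin n → Set
  Adj u v = adj u v ≡ true

  data Walk : Fin n → Fin n → Set where
    here : ∀ {v} → Walk v v
    step : ∀ {u w v} → Adj u w → Walk w v → Walk u v

  Connected : Set
  Connected = ∀ u v → Walk u v

  Cycle : Set
  Cycle = Σ (Fin n) λ v → Σ (List (Fin n)) λ ws →
            (2 Data.Nat.≤ length ws) × Unique (v ∷ ws) × Linked Adj (v ∷ ws ++ v ∷ [])

  IsTree : Set
  IsTree = Connected × ¬ Cycle

  reach : ℕ → Fin n → Fin n → Bool
  reach zero    u v = ⌊ u ≟ v ⌋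
  reach (suc k) u v = ⌊ u ≟ v ⌋ ∨ any (λ w → adj u w ∧ reach k w v) (allFin n)

  least : (ℕ → Bool) → ℕ → ℕ
  least p zero    = zero
  least p (suc k) = if p zero then zero else suc (least (λ i → p (suc i)) k)

  -- shortest-path distance; unreachable pairs get distance n, which exceeds
  -- every finite distance (≤ n - 1), i.e. it plays the role of ∞
  dist : Fin n → Fin n → ℕ
  dist u v = least (λ i → reach i u v) n

  -- distance from a vertex to a set of vertices (given as a list); ∞ (= n) if empty
  distSet : List (Fin n) → Fin n → ℕ
  distSet S v = foldr (λ s d → dist s v ⊓ d) n S

  -- twice A's payoff: each vertex strictly closer to A counts 2, each tie 1
  score2 : List (Fin n) → List (Fin n) → ℕ
  score2 as bs = sum (map val (allFin n))
    where
      val : Fin n → ℕ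
      val v = if distSet as v <ᵇ distSet bs v then 2
              else if distSet as v ≡ᵇ distSet bs v then 1 else 0

  claimed : List (Fin n) → Fin n → Bool
  claimed S v = any (λ s → ⌊ s ≟ v ⌋) S

  unclaimed : List (Fin n) → List (Fin n) → List (Fin n)
  unclaimed as bs = filter (λ v → Data.Bool.T? (not (claimed (as ++ bs) v))) (allFin n)

  maxOver : List (Fin n) → (Fin n → ℕ) → ℕ
  maxOver xs f = foldr (λ x m → f x ⊔ m) 0 xs

  -- neutral default 2n (the largest possible value of score2); never used when n ≥ 2t
  minOver : List (Fin n) → (Fin n → ℕ) → ℕ
  minOver xs f = foldr (λ x m → f x ⊓ m) (2 * n) xs

  mutual
    gameA : ℕ → List (Fin n) → List (Fin n) → ℕ
    gameA zero    as bs = score2 as bs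
    gameA (suc r) as bs = maxOver (unclaimed as bs) (λ a → gameB r (a ∷ as) bs)

    gameB : ℕ → List (Fin n) → List (Fin n) → ℕ
    gameB r as bs = minOver (unclaimed as bs) (λ b → gameA r as (b ∷ bs))

-- The Voronoi ratio VR(G,t) = (A's vertices + half the tied ones) / |V(G)| under optimal play
VR : ∀ {n} → Graph n → ℕ → ℚ
VR {zero}  G t = + 0 / 1
VR {suc m} G t = (+ gameA G t [] []) / (2 * suc m)

{-# OPTIONS --safe #-}

-- (1) Call Branch(r → x) the component of x in T minus the edge rx.  Descending along edges one finds
-- r → x such that I = Branch(r → x) has at least n/3 vertices while every branch leaving x within I has
-- fewer.  If the rest of the tree splits at x into branches below n/3 as well, then x alone suffices: B
-- gains at most two branches.  Otherwise the same descent on the other side of x gives a disjoint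
-- J = Branch(r′ → x′), and at most n/3 vertices lie in neither.  Holding both x and x′ confines each
-- vertex of B to a piece of size at most n/3, so the only answer of B to x is x′ and conversely.  Let α be
-- the largest branch at x within I, and κ < n/3 a branch at x′ within J.  After x, x′ the vertex r′ leaves
-- B at most |J| + α; after x′, x the branch α leaves B at most n − |J| − α + κ.  The sum n + κ of the two
-- bounds is below 4n/3, so one of them is below 2n/3.
--
-- (2) Three legs of equal weight leave a root.  The weight of leg 2 sits at one vertex V next to the
-- root, that of legs 0 and 1 in many clusters at distances 3 ^ i from the root.  If B owns the start of
-- such a leg and answers each vertex of A on it by the next one outwards, then every vertex of A wins at
-- most one cluster there.  B always secures two of the three legs in this way: A's V is answered
-- by the root, a vertex of A on leg 0 or 1 also by the root (which guards the other leg, and leaves V and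
-- the first leg to be secured later), and anything else by V followed by the start of a leg.

module Submission where

open import Defs
import Algebra.Properties.Semiring.Sum
open import Data.Bool using (Bool; true; false; T; T?; not; _∧_; if_then_else_) renaming (_≟_ to _≟ᵇ_)
open import Data.Bool.Properties using (T-≡; T-∧)
open import Data.Empty using (⊥; ⊥-elim)
open import Data.Fin using (Fin; zero; suc; toℕ; _≟_; fromℕ<; splitAt; join; _↑ˡ_; _↑ʳ_; remQuot; combine)
open import Data.Fin.Patterns using (0F; 1F; 2F)
open import Data.Fin.Properties using (any?; injective⇒≤; toℕ<n; toℕ-injective; toℕ-fromℕ<; splitAt-↑ˡ; splitAt-↑ʳ; join-splitAt; remQuot-combine; combine-remQuot) renaming (suc-injective to fsuc-injective)
open import Data.List using (List; []; _∷_; _++_; length; map; allFin; tabulate; lookup)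
open import Data.List.Membership.DecPropositional using () renaming (_∈?_ to mem?)
open import Data.List.Membership.Propositional using (_∈_; _∉_)
open import Data.List.Membership.Propositional.Properties using (∈-allFin; ∈-filter⁺; ∈-filter⁻; ∈-lookup; ∈-++⁺ˡ; ∈-++⁺ʳ; ∈-++⁻)
open import Data.List.Properties using (map-tabulate; length-++)
open import Data.List.Relation.Unary.All as All using (All; []; _∷_)
open import Data.List.Relation.Unary.All.Properties using (¬Any⇒All¬)
open import Data.List.Relation.Unary.AllPairs using ([]; _∷_)
open import Data.List.Relation.Unary.Any as Any using (Any; here; there)
open import Data.List.Relation.Unary.Any.Properties using (any⁺; any⁻; lookup-index)
open import Data.List.Relation.Unary.Linked using (Linked; [-]; _∷_)
open import Data.List.Relation.Unary.Unique.Propositional using (Unique)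
open import Data.Nat using (ℕ; zero; suc; _≤_; _*_; _∸_; _^_; ∣_-_∣; _<ᵇ_; _≡ᵇ_; z≤n; s≤s)
import Data.Nat as ℕ
open import Data.Nat.Coprimality using (Coprime)
open import Data.Nat.Induction using (<-wellFounded)
open import Data.Nat.ListAction using () renaming (sum to sumList)
open import Data.Nat.Properties hiding (_≟_)
import Data.Nat.Properties as ℕ
open import Data.Nat.Tactic.RingSolver using (solve-∀)
open import Data.Product using (∃; ∃-syntax; Σ; _×_; _,_; proj₁; proj₂)
open import Data.Sum using (_⊎_; inj₁; inj₂; [_,_]′; swap)
open import Data.Unit using (⊤; tt)
open import Function using (_∘_; id; Equivalence; mk⇔)
open import Induction.WellFounded using (Acc; acc)
open import Relation.Binary.Definitions using (tri<; tri≈; tri>)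
open import Relation.Binary.PropositionalEquality hiding (J)
open import Relation.Nullary using (¬_; Dec; yes; no; contradiction; does)
open import Relation.Nullary.Decidable using (⌊_⌋; toWitness; dec-true; dec-false; does-⇔; isYes≗does; ¬?; _×-dec_; _⊎-dec_; decidable-stable)
open import Relation.Unary using (Decidable)
open Algebra.Properties.Semiring.Sum +-*-semiring using (sum; ∑-distrib-+; sum-cong-≗; *-distribˡ-sum)

module Combinatorics where
  open import Data.Nat using (_<_; _+_)

  -- Counting by sums of indicators

  ⟦_⟧ : {P : Set} → Dec P → ℕ
  ⟦ P? ⟧ = if does P? then 1 else 0

  1≤⟦⟧ : {P : Set} (P? : Dec P) → P → 1 ≤ ⟦ P? ⟧
  1≤⟦⟧ (yes _) p = ≤-refl
  1≤⟦⟧ (no ¬p) p = contradiction p ¬p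

  ⟦⟧-exclusive : {P Q : Set} (P? : Dec P) (Q? : Dec Q) → (P → ¬ Q) → (¬ P → Q) → ⟦ P? ⟧ + ⟦ Q? ⟧ ≡ 1
  ⟦⟧-exclusive (yes p) (yes q) p⇒¬q ¬p⇒q = contradiction q (p⇒¬q p)
  ⟦⟧-exclusive (yes p) (no ¬q) p⇒¬q ¬p⇒q = refl
  ⟦⟧-exclusive (no ¬p) (yes q) p⇒¬q ¬p⇒q = refl
  ⟦⟧-exclusive (no ¬p) (no ¬q) p⇒¬q ¬p⇒q = contradiction (¬p⇒q ¬p) ¬q

  card : ∀ {n} {P : Fin n → Set} → Decidable P → ℕ
  card P? = sum λ w → ⟦ P? w ⟧

  sum-mono : ∀ {n} {f g : Fin n → ℕ} → (∀ i → f i ≤ g i) → sum f ≤ sum g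
  sum-mono {zero}  f≤g = z≤n
  sum-mono {suc n} f≤g = +-mono-≤ (f≤g zero) (sum-mono (f≤g ∘ suc))

  sum-const : ∀ n c → sum {n} (λ _ → c) ≡ n * c
  sum-const zero    c = refl
  sum-const (suc n) c = cong (c +_) (sum-const n c)

  card-unique : ∀ {n} {P : Fin n → Set} (P? : Decidable P) →
                (∀ {i j} → P i → P j → i ≡ j) → card P? ≤ 1
  card-unique {zero}  P? uniq = z≤n
  card-unique {suc n} P? uniq with P? zero
  ... | no  _  = card-unique (P? ∘ suc) λ p q → fsuc-injective (uniq p q)
  ... | yes p₀ = s≤s (subst (_≤ 0) (sym (trans (sum-cong-≗ zeroes) (sum-const n 0))) (≤-reflexive (*-zeroʳ n)))
    where
    zeroes : ∀ i → ⟦ P? (suc i) ⟧ ≡ 0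
    zeroes i with P? (suc i)
    ... | no  _ = refl
    ... | yes p with () ← uniq p₀ p

  card≥1 : ∀ {n} {P : Fin n → Set} (P? : Decidable P) {v} → P v → 1 ≤ card P?
  card≥1 {suc n} P? {zero}  p = ≤-trans (1≤⟦⟧ (P? zero) p) (m≤m+n _ _)
  card≥1 {suc n} P? {suc v} p = ≤-trans (card≥1 (P? ∘ suc) p) (m≤n+m _ _)

  card-⊂ : ∀ {n} {P Q : Fin n → Set} (P? : Decidable P) (Q? : Decidable Q) {v} →
           (∀ {w} → P w → Q w) → Q v → ¬ P v → card P? < card Q?
  card-⊂ P? Q? {v} P⊆Q q ¬p = begin
    1 + card P?                                ≤⟨ +-monoˡ-≤ _ (card≥1 (v ≟_) refl) ⟩
    card (v ≟_) + card P?                      ≡⟨ ∑-distrib-+ (λ w → ⟦ v ≟ w ⟧) (λ w → ⟦ P? w ⟧) ⟨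
    sum (λ w → ⟦ v ≟ w ⟧ + ⟦ P? w ⟧)           ≤⟨ sum-mono pointwise ⟩
    card Q?                                    ∎
    where
    open ≤-Reasoning
    pointwise : ∀ w → ⟦ v ≟ w ⟧ + ⟦ P? w ⟧ ≤ ⟦ Q? w ⟧
    pointwise w with v ≟ w | P? w
    ... | yes refl | yes p = contradiction p ¬p
    ... | yes refl | no _  = 1≤⟦⟧ (Q? w) q
    ... | no  _    | yes p = 1≤⟦⟧ (Q? w) (P⊆Q p)
    ... | no  _    | no _  = z≤n

  sumList-tabulate : ∀ {n} (f : Fin n → ℕ) → sumList (tabulate f) ≡ sum f
  sumList-tabulate {zero}  f = refl
  sumList-tabulate {suc n} f = cong (f zero +_) (sumList-tabulate (f ∘ suc))

  sumList-allFin : ∀ {n} (f : Fin n → ℕ) → sumList (map f (allFin n)) ≡ sum f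
  sumList-allFin f = trans (cong sumList (map-tabulate id f)) (sumList-tabulate f)

  lookup-unique : ∀ {A : Set} {xs : List A} → Unique xs → ∀ {i j} → lookup xs i ≡ lookup xs j → i ≡ j
  lookup-unique (x∉ ∷ u) {zero}  {zero}  eq = refl
  lookup-unique (x∉ ∷ u) {zero}  {suc j} eq = contradiction eq (All.lookup x∉ (∈-lookup j))
  lookup-unique (x∉ ∷ u) {suc i} {zero}  eq = contradiction (sym eq) (All.lookup x∉ (∈-lookup i))
  lookup-unique (x∉ ∷ u) {suc i} {suc j} eq = cong suc (lookup-unique u eq)

  unique⇒length≤ : ∀ {n} {xs : List (Fin n)} → Unique xs → length xs ≤ n
  unique⇒length≤ u = injective⇒≤ (lookup-unique u)

  _∈?_ : ∀ {n} (v : Fin n) (xs : List (Fin n)) → Dec (v ∈ xs)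
  _∈?_ = mem? _≟_

  -- Walks, simple paths and cycles

  module Paths {n : ℕ} (G : Graph n) where
    open Graph G

    Adj-sym : ∀ {u v} → Adj G u v → Adj G v u
    Adj-sym {u} {v} uv = trans (adj-sym v u) uv

    Adj-irrefl : ∀ {v} → ¬ Adj G v v
    Adj-irrefl {v} vv with () ← trans (sym vv) (irrefl v)

    Adj⇒≢ : ∀ {u v} → Adj G u v → u ≢ v
    Adj⇒≢ uv refl = Adj-irrefl uv

    data WalkIn (Q : Fin n → Set) : Fin n → Fin n → Set where
      done : ∀ {v} → Q v → WalkIn Q v v
      move : ∀ {u w v} → Q u → Adj G u w → WalkIn Q w v → WalkIn Q u v

    module _ {Q : Fin n → Set} where

      WalkIn-trans : ∀ {u w v} → WalkIn Q u w → WalkIn Q w v → WalkIn Q u v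
      WalkIn-trans (done _)     r = r
      WalkIn-trans (move q e p) r = move q e (WalkIn-trans p r)

      WalkIn-source : ∀ {u v} → WalkIn Q u v → Q u
      WalkIn-source (done q)     = q
      WalkIn-source (move q _ _) = q

      WalkIn-sym : ∀ {u v} → WalkIn Q u v → WalkIn Q v u
      WalkIn-sym (done q)     = done q
      WalkIn-sym (move q e p) =
        WalkIn-trans (WalkIn-sym p) (move (WalkIn-source p) (Adj-sym e) (done q))

    fromWalk : ∀ {u v} → Walk G u v → WalkIn (λ _ → ⊤) u v
    fromWalk here       = done tt
    fromWalk (step e w) = move tt e (fromWalk w)

    data Path : Fin n → Fin n → List (Fin n) → Set where
      stop : ∀ {v} → Path v v (v ∷ [])
      _∷_  : ∀ {u w v xs} → Adj G u w → Path w v xs → Path u v (u ∷ xs)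

    record SimplePathIn (Q : Fin n → Set) (u v : Fin n) : Set where
      constructor simplePath
      field
        {verts} : List (Fin n)
        path    : Path u v verts
        unique  : Unique verts
        within  : All Q verts

    suffix : ∀ {Q u w v xs} → u ∈ xs → Path w v xs → Unique xs → All Q xs → SimplePathIn Q u v
    suffix (here refl) p@stop    u        q       = simplePath p u q
    suffix (here refl) p@(_ ∷ _) u        q       = simplePath p u q
    suffix (there u∈)  (_ ∷ p)   (_ ∷ u)  (_ ∷ q) = suffix u∈ p u q

    loop-erase : ∀ {Q u v} → WalkIn Q u v → SimplePathIn Q u v
    loop-erase (done q) = simplePath stop ([] ∷ []) (q ∷ [])
    loop-erase {u = u} (move q e w) with loop-erase w
    ... | simplePath {xs} p uniq qs with u ∈? xs
    ...   | yes u∈ = suffix u∈ p uniq qs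
    ...   | no  u∉ = simplePath (e ∷ p) (¬Any⇒All¬ xs u∉ ∷ uniq) (q ∷ qs)

    close-path : ∀ {u v x y xs} → Adj G y u → Path u v xs → Adj G v x → Linked (Adj G) (y ∷ xs ++ x ∷ [])
    close-path yu stop    vx = yu ∷ vx ∷ [-]
    close-path yu (e ∷ p) vx = yu ∷ close-path e p vx

    Avoiding : Fin n → Fin n → Fin n → Set
    Avoiding x = WalkIn (x ≢_)

    -- Loop erasure turns the walk into a simple path off `x`. If that path has an edge, then `x`
    -- closes it up to a cycle.
    neighbours-separated : ¬ Cycle G → ∀ {x y y′} → Adj G x y → Adj G x y′ → Avoiding x y y′ → y ≡ y′
    neighbours-separated acyclic {x} {y} {y′} xy xy′ w with loop-erase w
    ... | simplePath stop _ _ = refl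
    ... | simplePath p@(_ ∷ p′) u q =
      contradiction (x , _ , 2≤ p p′ , q ∷ u , close-path xy p (Adj-sym xy′)) acyclic
      where
      2≤ : ∀ {a b c d xs z} → Path a b (z ∷ xs) → Path c d xs → 2 ≤ length (z ∷ xs)
      2≤ _ stop    = ≤-refl
      2≤ _ (_ ∷ _) = s≤s (s≤s z≤n)

  -- Shortest-path distance

  least-≤ : ∀ {n} (G : Graph n) (p : ℕ → Bool) k i → p i ≡ true → least G p k ≤ i
  least-≤ G p zero    i       pi = z≤n
  least-≤ G p (suc k) zero    pi rewrite pi = z≤n
  least-≤ G p (suc k) (suc i) pi with p 0
  ... | true  = z≤n
  ... | false = s≤s (least-≤ G (p ∘ suc) k i pi)

  least-sat : ∀ {n} (G : Graph n) (p : ℕ → Bool) k → least G p k < k → p (least G p k) ≡ true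
  least-sat G p (suc k) l< with p 0 in p0
  ... | true  = p0
  ... | false = least-sat G (p ∘ suc) k (≤-pred l<)

  ≟-refl : ∀ {n} (v : Fin n) → ⌊ v ≟ v ⌋ ≡ true
  ≟-refl v = trans (isYes≗does (v ≟ v)) (dec-true (v ≟ v) refl)

  module Distance {n : ℕ} (G : Graph n) (connected : Connected G) where
    open Graph G
    open Paths G public

    d : Fin n → Fin n → ℕ
    d = dist G

    reach-refl : ∀ k v → reach G k v v ≡ true
    reach-refl zero    v = ≟-refl v
    reach-refl (suc k) v rewrite ≟-refl v = refl

    reach-step : ∀ {k u w v} → Adj G u w → reach G k w v ≡ true → reach G (suc k) u v ≡ true
    reach-step {k} {u} {w} {v} uw wv with u ≟ v
    ... | yes _ = refl
    ... | no  _ = Equivalence.to T-≡ (any⁺ _ (Any.map (λ { refl → good }) (∈-allFin w)))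
      where
      good : T (adj u w ∧ reach G k w v)
      good rewrite uw | wv = tt

    reach-inv : ∀ {k u v} → u ≢ v → reach G (suc k) u v ≡ true → ∃[ w ] Adj G u w × reach G k w v ≡ true
    reach-inv {k} {u} {v} u≢v r with u ≟ v
    ... | yes u≡v = contradiction u≡v u≢v
    ... | no  _ with Any.satisfied (any⁻ _ (allFin n) (Equivalence.from T-≡ r))
    ...   | w , t with Equivalence.to T-∧ t
    ...     | uw , wv = w , Equivalence.to T-≡ uw , Equivalence.to T-≡ wv

    path⇒reach : ∀ {u v x xs} → Path u v (x ∷ xs) → reach G (length xs) u v ≡ true
    path⇒reach stop                  = reach-refl 0 _
    path⇒reach (e ∷ p@stop)          = reach-step {0} e (path⇒reach p)
    path⇒reach (_∷_ {xs = _ ∷ xs} e p@(_ ∷ _)) = reach-step {length xs} e (path⇒reach p)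

    -- A simple path has at most `n` vertices, hence fewer than `n` edges, so the search in `dist`
    -- succeeds before its cutoff. This is what makes the value found a genuine distance in
    -- `d-reach`.
    d< : ∀ u v → d u v < n
    d< u v with loop-erase (fromWalk (connected u v))
    ... | simplePath {_ ∷ xs} p uniq _ =
      ≤-trans (s≤s (least-≤ G _ n (length xs) (path⇒reach p))) (unique⇒length≤ uniq)

    d-reach : ∀ u v → reach G (d u v) u v ≡ true
    d-reach u v = least-sat G _ n (d< u v)

    d-refl : ∀ v → d v v ≡ 0
    d-refl v = n≤0⇒n≡0 (least-≤ G _ n 0 (reach-refl 0 v))

    d≡0⇒≡ : ∀ {u v} → d u v ≡ 0 → u ≡ v
    d≡0⇒≡ {u} {v} eq with u ≟ v | subst (λ k → reach G k u v ≡ true) eq (d-reach u v)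
    ... | yes u≡v | _ = u≡v
    ... | no  _   | ()

    d>0 : ∀ {u v} → u ≢ v → 0 < d u v
    d>0 u≢v = n≢0⇒n>0 (u≢v ∘ d≡0⇒≡)

    d-step : ∀ {u w} v → Adj G u w → d u v ≤ suc (d w v)
    d-step {u} {w} v uw = least-≤ G _ n _ (reach-step {d w v} uw (d-reach w v))

    -- Geodesics enter the later arguments only through this first step of a shortest walk.
    closer-neighbour : ∀ {u v} → u ≢ v → ∃[ w ] Adj G u w × suc (d w v) ≡ d u v
    closer-neighbour {u} {v} u≢v with d u v in eq | d-reach u v
    ... | zero  | _ = contradiction (d≡0⇒≡ eq) u≢v
    ... | suc k | r with reach-inv {k} u≢v r
    ...   | w , uw , wv = w , uw ,
      ≤-antisym (s≤s (least-≤ G _ n k wv)) (subst (_≤ suc (d w v)) eq (d-step v uw))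

  -- Game values and scores

  ∃∉ : ∀ {n} (xs : List (Fin n)) → length xs < n → ∃[ v ] v ∉ xs
  ∃∉ {n} xs len< with any? (λ v → ¬? (v ∈? xs))
  ... | yes r = r
  ... | no ¬∃ = contradiction (injective⇒≤ index-injective) (<⇒≱ len<)
    where
    all∈ : ∀ v → v ∈ xs
    all∈ v = decidable-stable (v ∈? xs) λ v∉ → ¬∃ (v , v∉)
    index-injective : ∀ {u v} → Any.index (all∈ u) ≡ Any.index (all∈ v) → u ≡ v
    index-injective {u} {v} eq =
      trans (lookup-index (all∈ u)) (trans (cong (lookup xs) eq) (sym (lookup-index (all∈ v))))

  module Game {n : ℕ} (G : Graph n) where

    claimed⇒∈ : ∀ xs {v} → T (claimed G xs v) → v ∈ xs
    claimed⇒∈ xs t = Any.map (λ eq → sym (toWitness eq)) (any⁻ _ xs t)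

    ∈⇒claimed : ∀ xs {v} → v ∈ xs → T (claimed G xs v)
    ∈⇒claimed xs {v} v∈ = any⁺ _ (Any.map (λ { refl → Equivalence.from T-≡ (≟-refl v) }) v∈)

    unclaimed⁺ : ∀ {as bs v} → v ∉ as → v ∉ bs → v ∈ unclaimed G as bs
    unclaimed⁺ {as} {bs} {v} v∉as v∉bs =
      ∈-filter⁺ (λ v → T? (not (claimed G (as ++ bs) v))) (∈-allFin v) (unclaimed-T _ λ t →
        [ v∉as , v∉bs ]′ (∈-++⁻ as (claimed⇒∈ (as ++ bs) t)))
      where
      unclaimed-T : ∀ c → ¬ T c → T (not c)
      unclaimed-T true  ¬t = ¬t tt
      unclaimed-T false _  = tt

    unclaimed⁻ : ∀ {as bs v} → v ∈ unclaimed G as bs → v ∉ as × v ∉ bs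
    unclaimed⁻ {as} {bs} {v} v∈ = ∉-++ ∘ ∈-++⁺ˡ , ∉-++ ∘ ∈-++⁺ʳ as
      where
      ∉-++ : v ∉ as ++ bs
      ∉-++ v∈++ with claimed G (as ++ bs) v | ∈⇒claimed (as ++ bs) v∈++
                   | proj₂ (∈-filter⁻ (λ v → T? (not (claimed G (as ++ bs) v))) {xs = allFin n} v∈)
      ... | true | _ | ()

    max-win : ∀ {W : ℕ → Set} → (∀ {k l} → k ≤ l → W k → W l) →
              ∀ {f x xs} → x ∈ xs → W (f x) → W (maxOver G xs f)
    max-win up (here refl) w = up (m≤m⊔n _ _) w
    max-win up (there x∈)  w = up (m≤n⊔m _ _) (max-win up x∈ w)

    max-all : ∀ {k f} xs → (∀ {x} → x ∈ xs → f x ≤ k) → maxOver G xs f ≤ k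
    max-all []       f≤ = z≤n
    max-all (x ∷ xs) f≤ = ⊔-lub (f≤ (here refl)) (max-all xs (f≤ ∘ there))

    -- `minOver` also takes the minimum with its default `2 * n`, so the default has to satisfy `W`
    -- as well.
    min-all : ∀ {W : ℕ → Set} {f} xs → W (2 * n) → (∀ {x} → x ∈ xs → W (f x)) → W (minOver G xs f)
    min-all []       w₀ w = w₀
    min-all {W} {f} (x ∷ xs) w₀ w with ⊓-sel (f x) (minOver G xs f)
    ... | inj₁ eq = subst W (sym eq) (w (here refl))
    ... | inj₂ eq = subst W (sym eq) (min-all {W} xs w₀ (w ∘ there))

    min-≤ : ∀ {f x xs} → x ∈ xs → minOver G xs f ≤ f x
    min-≤ (here refl) = m⊓n≤m _ _
    min-≤ (there x∈)  = ≤-trans (m⊓n≤n _ _) (min-≤ x∈)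

    distSet-≤ : ∀ {S s} v → s ∈ S → distSet G S v ≤ dist G s v
    distSet-≤ v (here refl) = m⊓n≤m _ _
    distSet-≤ v (there s∈)  = ≤-trans (m⊓n≤n _ _) (distSet-≤ v s∈)

    distSet-≥ : ∀ {k v} S → k ≤ n → (∀ {s} → s ∈ S → k ≤ dist G s v) → k ≤ distSet G S v
    distSet-≥ []      k≤n k≤ = k≤n
    distSet-≥ (s ∷ S) k≤n k≤ = ⊓-glb (k≤ (here refl)) (distSet-≥ S k≤n (k≤ ∘ there))

  module Score {n : ℕ} (G : Graph n) (connected : Connected G) where
    open Game G public
    open Distance G connected public

    -- The vertex `x` may depend on `y`: different vertices of `xs` can take care of different
    -- rivals.
    Beats : List (Fin n) → List (Fin n) → Fin n → Set
    Beats xs ys w = ∀ {y} → y ∈ ys → ∃[ x ] x ∈ xs × d x w < d y w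

    -- The member `x₀` keeps the left side below `n`, the value of `distSet` on an empty `ys`.
    Beats⇒< : ∀ {xs ys x₀ w} → x₀ ∈ xs → Beats xs ys w → distSet G xs w < distSet G ys w
    Beats⇒< {xs} {ys} {x₀} {w} x₀∈ beats = distSet-≥ ys (≤-trans (s≤s (distSet-≤ w x₀∈)) (d< x₀ w)) λ y∈ →
      let x , x∈ , lt = beats y∈ in ≤-trans (s≤s (distSet-≤ w x∈)) lt

    Owns : List (Fin n) → List (Fin n) → Fin n → Set
    Owns xs ys w = distSet G xs w < distSet G ys w

    owns? : ∀ xs ys → Decidable (Owns xs ys)
    owns? xs ys w = distSet G xs w <? distSet G ys w

    payoff : ℕ → ℕ → ℕ
    payoff x y = if x <ᵇ y then 2 else if x ≡ᵇ y then 1 else 0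

    payoffs : List (Fin n) → List (Fin n) → Fin n → ℕ
    payoffs as bs v = payoff (distSet G as v) (distSet G bs v)

    score2-sum : ∀ as bs → score2 G as bs ≡ sum (payoffs as bs)
    score2-sum as bs = sumList-allFin (payoffs as bs)

    score-lower : ∀ as bs → 2 * card (owns? as bs) ≤ score2 G as bs
    score-lower as bs = begin
      2 * card (owns? as bs)                  ≡⟨ *-distribˡ-sum 2 (λ w → ⟦ owns? as bs w ⟧) ⟩
      sum (λ w → 2 * ⟦ owns? as bs w ⟧)       ≤⟨ sum-mono (λ w → pointwise (distSet G as w) (distSet G bs w)) ⟩
      sum (payoffs as bs)                     ≡⟨ score2-sum as bs ⟨
      score2 G as bs                          ∎
      where
      open ≤-Reasoning
      pointwise : ∀ x y → 2 * ⟦ x <? y ⟧ ≤ payoff x y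
      pointwise x y with x <ᵇ y
      ... | true  = ≤-refl
      ... | false = z≤n

    -- Ties are charged to A in full, and `f` may overcount, so several kinds of exceptional
    -- vertices can simply be added up.
    score-upper : ∀ as bs (f : Fin n → ℕ) → (∀ w → Owns bs as w ⊎ 1 ≤ f w) → score2 G as bs ≤ 2 * sum f
    score-upper as bs f cover = begin
      score2 G as bs         ≡⟨ score2-sum as bs ⟩
      sum (payoffs as bs)    ≤⟨ sum-mono (λ w → pointwise (distSet G as w) (distSet G bs w) (f w) (cover w)) ⟩
      sum (λ w → 2 * f w)    ≡⟨ *-distribˡ-sum 2 f ⟨
      2 * sum f              ∎
      where
      open ≤-Reasoning
      pointwise : ∀ x y k → y < x ⊎ 1 ≤ k → payoff x y ≤ 2 * k
      pointwise x y k (inj₂ 1≤k) = ≤-trans ≤2 (*-monoʳ-≤ 2 1≤k)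
        where
        ≤2 : payoff x y ≤ 2
        ≤2 with x <ᵇ y | x ≡ᵇ y
        ... | true  | _     = ≤-refl
        ... | false | true  = s≤s z≤n
        ... | false | false = z≤n
      pointwise x y k (inj₁ y<x) with x <ᵇ y in lt | x ≡ᵇ y in eq
      ... | true  | _     = contradiction (<ᵇ⇒< x y (Equivalence.from T-≡ lt)) (<⇒≯ y<x)
      ... | false | true  = contradiction (≡ᵇ⇒≡ x y (Equivalence.from T-≡ eq)) (>⇒≢ y<x)
      ... | false | false = z≤n

  -- Branches of a tree

  module Branches {n : ℕ} (T : Graph n) (tree : IsTree T) where
    open Score T (proj₁ tree) public

    -- Along a geodesic from `u` to `w` the distance to `w` is below `d x w` from the second vertex
    -- on, so the geodesic cannot meet `x`.
    avoiding : ∀ {x u w} → x ≢ u → d u w ≤ d x w → Avoiding x u w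
    avoiding {x} {u} {w} x≢u near = go _ x≢u near refl
      where
      go : ∀ k {u} → x ≢ u → d u w ≤ d x w → d u w ≡ k → Avoiding x u w
      go k {u} x≢u near eq with u ≟ w
      go k       x≢u near eq | yes refl = done x≢u
      go k       x≢u near eq | no  u≢w with closer-neighbour u≢w
      go zero    x≢u near eq | no  u≢w | _ , _ , lt = contradiction (trans lt eq) λ ()
      go (suc k) x≢u near eq | no  u≢w | v , uv , lt =
        move x≢u uv (go k (λ { refl → <-irrefl refl closer }) (<⇒≤ closer) (suc-injective (trans lt eq)))
        where
        closer : d v w < d x w
        closer = ≤-trans (≤-reflexive lt) near

    avoiding-neighbours : ∀ {x y y′} → Adj T x y → Adj T x y′ → Avoiding x y y′ → y ≡ y′
    avoiding-neighbours = neighbours-separated (proj₂ tree)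

    near-neighbour-unique : ∀ {x y y′ w} → Adj T x y → Adj T x y′ →
                            d y w ≤ d x w → d y′ w ≤ d x w → y ≡ y′
    near-neighbour-unique xy xy′ near near′ = avoiding-neighbours xy xy′
      (WalkIn-trans (avoiding (Adj⇒≢ xy) near) (WalkIn-sym (avoiding (Adj⇒≢ xy′) near′)))

    -- For adjacent x and y this is the vertex set of the component of y in T − xy.
    Branch : Fin n → Fin n → Fin n → Set
    Branch x y w = d y w < d x w

    branch? : ∀ x y → Decidable (Branch x y)
    branch? x y w = d y w <? d x w

    size : Fin n → Fin n → ℕ
    size x y = card (branch? x y)

    ∉branch-base : ∀ {x y} → ¬ Branch x y x
    ∉branch-base {x} {y} lt with () ← subst (d y x <_) (d-refl x) lt

    ∈branch-tip : ∀ {x y} → x ≢ y → Branch x y y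
    ∈branch-tip {x} {y} x≢y = subst (_< d x y) (sym (d-refl y)) (d>0 x≢y)

    -- A tie across an edge is impossible: the neighbour of `x` strictly nearer to `w` would have to
    -- be `y` by uniqueness.
    branch-flip : ∀ {x y w} → Adj T x y → ¬ Branch x y w → Branch y x w
    branch-flip {x} {y} {w} xy w∉ = ≤∧≢⇒< (≮⇒≥ w∉) λ eq →
      let z , xz , lt = closer-neighbour {x} {w} λ { refl → Adj⇒≢ xy (sym (d≡0⇒≡ (trans (sym eq) (d-refl x)))) }
          z≡y         = near-neighbour-unique xz xy (≤-trans (n≤1+n _) (≤-reflexive lt)) (≤-reflexive (sym eq))
      in 1+n≢n (trans (subst (λ v → suc (d v w) ≡ d x w) z≡y lt) eq)

    branch-exclusive : ∀ {x y w} → Branch x y w → ¬ Branch y x w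
    branch-exclusive = <⇒≯

    toward : ∀ {x w} → x ≢ w → ∃[ y ] Adj T x y × Branch x y w
    toward x≢w with closer-neighbour x≢w
    ... | y , xy , lt = y , xy , ≤-reflexive lt

    child⊆ : ∀ {x y r w} → Adj T x y → Adj T x r → y ≢ r → Branch x y w → Branch r x w
    child⊆ xy xr y≢r w∈ = ≰⇒> λ near → y≢r (near-neighbour-unique xy xr (<⇒≤ w∈) near)

    -- If `b` were as near to `w` as `x` is, a walk off `x` would lead from `y` through `b` and `w`
    -- to the neighbour of `x` towards `w`. That neighbour would be `y`, and `w` would lie in the
    -- branch. This is how a vertex of A confines a vertex of B.
    base-separates : ∀ {x y b w} → Adj T x y → Branch x y b → ¬ Branch x y w → d x w < d b w
    base-separates {x} {y} {b} {w} xy b∈ w∉ = ≰⇒> λ near → w∉ (y-near near)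
      where
      x≢b : x ≢ b
      x≢b refl = ∉branch-base b∈
      y-near : d b w ≤ d x w → Branch x y w
      y-near near with x ≟ w
      ... | yes refl = contradiction (sym (d≡0⇒≡ (n≤0⇒n≡0 (subst (d b x ≤_) (d-refl x) near)))) x≢b
      ... | no  x≢w with toward x≢w
      ...   | z , xz , w∈z = subst (λ v → Branch x v w) z≡y w∈z
        where
        z≡y : z ≡ y
        z≡y = sym (avoiding-neighbours xy xz
          (WalkIn-trans (avoiding (Adj⇒≢ xy) (<⇒≤ b∈))
          (WalkIn-trans (avoiding x≢b near)
          (WalkIn-sym (avoiding (Adj⇒≢ xz) (<⇒≤ w∈z))))))

    size-complement : ∀ {x y} → Adj T x y → size x y + size y x ≡ n
    size-complement {x} {y} xy = trans (sym (∑-distrib-+ (λ w → ⟦ branch? x y w ⟧) (λ w → ⟦ branch? y x w ⟧)))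
      (trans (sum-cong-≗ pointwise) (trans (sum-const n 1) (*-identityʳ n)))
      where
      pointwise : ∀ w → ⟦ branch? x y w ⟧ + ⟦ branch? y x w ⟧ ≡ 1
      pointwise w = ⟦⟧-exclusive (branch? x y w) (branch? y x w) branch-exclusive (branch-flip xy)

    child-smaller : ∀ {x y r} → Adj T x y → Adj T x r → y ≢ r → size x y < size r x
    child-smaller {x} {y} {r} xy xr y≢r = card-⊂ (branch? x y) (branch? r x) {x}
      (child⊆ xy xr y≢r) (∈branch-tip (Adj⇒≢ xr ∘ sym)) ∉branch-base

    adj? : ∀ u v → Dec (Adj T u v)
    adj? u v = Graph.adj T u v ≟ᵇ true

    record Minimal (r x : Fin n) : Set where
      field
        edge     : Adj T x r
        large    : n ≤ 3 * size r x
        children : ∀ {y} → Adj T x y → y ≢ r → 3 * size x y < n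

    -- The descent ends because child branches are strictly smaller. The inclusion is what makes a
    -- second descent, from the other side of the edge, end in a disjoint branch.
    minimal-below : ∀ {r x} → Adj T x r → n ≤ 3 * size r x →
                    ∃[ r′ ] ∃[ x′ ] Minimal r′ x′ × (∀ {w} → Branch r′ x′ w → Branch r x w)
    minimal-below {r} {x} xr large = go xr large (<-wellFounded _)
      where
      go : ∀ {r x} → Adj T x r → n ≤ 3 * size r x → Acc _<_ (size r x) →
           ∃[ r′ ] ∃[ x′ ] Minimal r′ x′ × (∀ {w} → Branch r′ x′ w → Branch r x w)
      go {r} {x} xr large (acc rec) with any? (λ y → adj? x y ×-dec ¬? (y ≟ r) ×-dec (n ≤? 3 * size x y))
      ... | no ¬∃ = r , x , record
        { edge = xr ; large = large ; children = λ xy y≢r → ≰⇒> λ n≤ → ¬∃ (_ , xy , y≢r , n≤) } , id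
      ... | yes (y , xy , y≢r , large′) =
        let r′ , x′ , min , sub = go (Adj-sym xy) large′ (rec (child-smaller xy xr y≢r))
        in r′ , x′ , min , child⊆ xy xr y≢r ∘ sub

  -- The two-round game on an arbitrary tree

  argmax : ∀ {n} {P : Fin n → Set} → Decidable P → (f : Fin n → ℕ) → ∃ P →
           ∃[ z ] P z × (∀ {y} → P y → f y ≤ f z)
  argmax {zero}  P? f (() , _)
  argmax {suc n} {P} P? f (v , p) with any? (P? ∘ suc) | P? zero
  ... | no ¬∃ | no ¬p₀ = contradiction p (none v)
    where
    none : ∀ v → ¬ P v
    none zero    = ¬p₀
    none (suc v) = λ p → ¬∃ (v , p)
  ... | no ¬∃ | yes p₀ = zero , p₀ , λ { {zero} _ → ≤-refl ; {suc y} py → contradiction (y , py) ¬∃ }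
  ... | yes ∃p | p₀? with argmax (P? ∘ suc) (f ∘ suc) ∃p
  ...   | z , pz , max with p₀? | f zero ≤? f (suc z)
  ...     | yes p₀ | no f0≰ = zero , p₀ , λ { {zero} _ → ≤-refl ; {suc y} py → ≤-trans (max py) (<⇒≤ (≰⇒> f0≰)) }
  ...     | yes p₀ | yes f0≤ = suc z , pz , λ { {zero} _ → f0≤ ; {suc y} py → max py }
  ...     | no ¬p₀ | _ = suc z , pz , λ { {zero} py → contradiction py ¬p₀ ; {suc y} py → max py }

  1≤⟦⟧-cover : {M N O : Set} (M? : Dec M) (N? : Dec N) (O? : Dec O) →
               (¬ M → ¬ N → O) → 1 ≤ ⟦ O? ⟧ + (⟦ M? ⟧ + ⟦ N? ⟧)
  1≤⟦⟧-cover (yes _) _       O? cover = ≤-trans (s≤s z≤n) (m≤n+m _ ⟦ O? ⟧)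
  1≤⟦⟧-cover (no  _) (yes _) O? cover = m≤n+m 1 ⟦ O? ⟧
  1≤⟦⟧-cover (no ¬m) (no ¬n) O? cover = ≤-trans (1≤⟦⟧ O? (cover ¬m ¬n)) (m≤m+n _ _)

  ⟦⟧-cover : {P Q M N O : Set} (P? : Dec P) (Q? : Dec Q) (M? : Dec M) (N? : Dec N) (O? : Dec O) →
             (P → ¬ Q) → (P ⊎ Q → ¬ M → ¬ N → O) → ⟦ P? ⟧ + ⟦ Q? ⟧ ≤ ⟦ O? ⟧ + (⟦ M? ⟧ + ⟦ N? ⟧)
  ⟦⟧-cover (yes p) (yes q) M? N? O? disjoint cover = contradiction q (disjoint p)
  ⟦⟧-cover (yes p) (no  _) M? N? O? disjoint cover = 1≤⟦⟧-cover M? N? O? (cover (inj₁ p))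
  ⟦⟧-cover (no  _) (yes q) M? N? O? disjoint cover = 1≤⟦⟧-cover M? N? O? (cover (inj₂ q))
  ⟦⟧-cover (no  _) (no  _) M? N? O? disjoint cover = z≤n

  none? : ∀ {n} → Decidable {A = Fin n} (λ _ → ⊥)
  none? _ = no id

  all? : ∀ {n} → Decidable {A = Fin n} (λ _ → ⊤)
  all? _ = yes tt

  card-none : ∀ n → card {n} none? ≡ 0
  card-none n = trans (sum-const n 0) (*-zeroʳ n)

  card-all : ∀ n → card {n} all? ≡ n
  card-all n = trans (sum-const n 1) (*-identityʳ n)

  2*≡+ : ∀ m → 2 * m ≡ m + m
  2*≡+ m = cong (m +_) (+-identityʳ m)

  two-thirds : ∀ {n} k l → 3 * k < n → 3 * l ≤ n → 3 * (k + l) < 2 * n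
  two-thirds {n} k l k< l≤ = begin-strict
    3 * (k + l)    ≡⟨ *-distribˡ-+ 3 k l ⟩
    3 * k + 3 * l  <⟨ +-mono-<-≤ k< l≤ ⟩
    n + n          ≡⟨ 2*≡+ n ⟨
    2 * n          ∎
    where open ≤-Reasoning

  module TwoRounds {n : ℕ} (T : Graph n) (tree : IsTree T) (4≤n : 4 ≤ n) where
    open Branches T tree

    -- The argument is the doubled payoff, so the ratio to be compared with 1/3 is `s` over `2 * n`.
    Win : ℕ → Set
    Win s = 2 * n < 3 * s

    0<n : 0 < n
    0<n = ≤-trans (s≤s z≤n) 4≤n

    record Won (as bs : List (Fin n)) : Set where
      constructor won
      field score : Win (score2 T as bs)

    -- A owns the disjoint sets `P` and `Q` except for what lies in `M` or `N`, hence more than n/3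
    -- vertices. The exceptional sizes are added on the left instead of being subtracted on the
    -- right.
    win-on : ∀ {as bs a} {P Q M N : Fin n → Set}
             (P? : Decidable P) (Q? : Decidable Q) (M? : Decidable M) (N? : Decidable N) → a ∈ as →
             (∀ {w} → P w → ¬ Q w) → (∀ {w} → P w ⊎ Q w → ¬ M w → ¬ N w → Beats as bs w) →
             n + 3 * (card M? + card N?) < 3 * (card P? + card Q?) → Won as bs
    win-on {as} {bs} P? Q? M? N? a∈ disjoint beats bound = won (begin-strict
      2 * n             <⟨ *-monoʳ-< 2 n<3c ⟩
      2 * (3 * c)       ≡⟨ trans (sym (*-assoc 2 3 c)) (*-assoc 3 2 c) ⟩
      3 * (2 * c)       ≤⟨ *-monoʳ-≤ 3 (score-lower as bs) ⟩
      3 * score2 T as bs ∎)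
      where
      open ≤-Reasoning
      c e : ℕ
      c = card (owns? as bs)
      e = card M? + card N?
      counts : card P? + card Q? ≤ c + e
      counts = begin
        card P? + card Q?                       ≡⟨ ∑-distrib-+ (λ w → ⟦ P? w ⟧) (λ w → ⟦ Q? w ⟧) ⟨
        sum (λ w → ⟦ P? w ⟧ + ⟦ Q? w ⟧)         ≤⟨ sum-mono (λ w → ⟦⟧-cover (P? w) (Q? w) (M? w) (N? w) (owns? as bs w)
                                                     disjoint (λ pq ¬m ¬n → Beats⇒< a∈ (beats pq ¬m ¬n))) ⟩
        sum (λ w → ⟦ owns? as bs w ⟧ + (⟦ M? w ⟧ + ⟦ N? w ⟧))
          ≡⟨ ∑-distrib-+ (λ w → ⟦ owns? as bs w ⟧) (λ w → ⟦ M? w ⟧ + ⟦ N? w ⟧) ⟩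
        c + sum (λ w → ⟦ M? w ⟧ + ⟦ N? w ⟧)     ≡⟨ cong (c +_) (∑-distrib-+ (λ w → ⟦ M? w ⟧) (λ w → ⟦ N? w ⟧)) ⟩
        c + e                                   ∎
      n<3c : n < 3 * c
      n<3c = +-cancelʳ-< (3 * e) n (3 * c) (begin-strict
        n + 3 * e                  <⟨ bound ⟩
        3 * (card P? + card Q?)    ≤⟨ *-monoʳ-≤ 3 counts ⟩
        3 * (c + e)                ≡⟨ *-distribˡ-+ 3 c e ⟩
        3 * c + 3 * e              ∎)

    win-outside : ∀ {as bs a} {M N : Fin n → Set} (M? : Decidable M) (N? : Decidable N) → a ∈ as →
                  (∀ {w} → ¬ M w → ¬ N w → Beats as bs w) →
                  3 * (card M? + card N?) < 2 * n → Won as bs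
    win-outside M? N? a∈ beats bound = win-on all? none? M? N? a∈ (λ _ ()) (λ _ → beats)
      (subst (λ k → n + 3 * (card M? + card N?) < 3 * k)
        (sym (trans (cong₂ _+_ (card-all n) (card-none n)) (+-identityʳ n))) (+-monoʳ-< n bound))

    -- A branch with exactly n/3 vertices misses the strict inequality; the extra vertex `v`
    -- supplies it.
    win-branch-and : ∀ {as bs a p q} v → a ∈ as → n ≤ 3 * size p q → ¬ Branch p q v → Beats as bs v →
                     (∀ {w} → Branch p q w → Beats as bs w) → Won as bs
    win-branch-and {p = p} {q} v a∈ large v∉ beats-v beats = win-on (branch? p q) (v ≟_) none? none? a∈
      (λ { v∈ refl → v∉ v∈ }) (λ { (inj₁ w∈) _ _ → beats w∈ ; (inj₂ refl) _ _ → beats-v }) (begin-strict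
        n + 3 * (card {n} none? + card {n} none?)  ≡⟨ cong (λ k → n + 3 * (k + k)) (card-none n) ⟩
        n + 0                              ≡⟨ +-identityʳ n ⟩
        n                                  ≤⟨ large ⟩
        3 * size p q                       <⟨ *-monoʳ-< 3 (m<m+n (size p q) (card≥1 (v ≟_) refl)) ⟩
        3 * (size p q + card (v ≟_))       ∎)
      where open ≤-Reasoning

    WinsFrom : Fin n → Set
    WinsFrom a = ∀ b → b ≢ a → ∃[ a′ ] a′ ≢ a × a′ ≢ b ×
      (∀ b′ → b′ ≢ a → b′ ≢ a′ → b′ ≢ b → Won (a′ ∷ a ∷ []) (b′ ∷ b ∷ []))

    wins : ∀ {a} → WinsFrom a → Win (gameA T 2 [] [])
    wins {a} w = max-win up (unclaimed⁺ {[]} {[]} {a} (λ ()) (λ ())) (min-all {Win} (unclaimed T (a ∷ []) []) full after-b)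
      where
      up : ∀ {k l} → k ≤ l → Win k → Win l
      up k≤l wk = <-≤-trans wk (*-monoʳ-≤ 3 k≤l)
      full : Win (2 * n)
      full = m<m+n (2 * n) (≤-trans 0<n (≤-trans (m≤m+n n _) (m≤m+n (2 * n) _)))
      after-b : ∀ {b} → b ∈ unclaimed T (a ∷ []) [] → Win (gameA T 1 (a ∷ []) (b ∷ []))
      after-b {b} b∈ with w b (λ { refl → proj₁ (unclaimed⁻ {a ∷ []} {[]} b∈) (here refl) })
      ... | a′ , a′≢a , a′≢b , final =
        max-win up (unclaimed⁺ {a ∷ []} {b ∷ []} {a′} (λ { (here eq) → a′≢a eq }) (λ { (here eq) → a′≢b eq }))
          (min-all {Win} (unclaimed T (a′ ∷ a ∷ []) (b ∷ [])) full λ {b′} b′∈ →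
            let ∉as , ∉bs = unclaimed⁻ {a′ ∷ a ∷ []} {b ∷ []} b′∈
            in Won.score (final b′ (λ { refl → ∉as (there (here refl)) }) (λ { refl → ∉as (here refl) }) (λ { refl → ∉bs (here refl) })))

    spare : ∀ a b → ∃[ a′ ] a′ ≢ a × a′ ≢ b
    spare a b with ∃∉ (a ∷ b ∷ []) (≤-trans (s≤s (s≤s (s≤s z≤n))) 4≤n)
    ... | a′ , a′∉ = a′ , (λ { refl → a′∉ (here refl) }) , (λ { refl → a′∉ (there (here refl)) })

    Nearer : List (Fin n) → Fin n → Fin n → Set
    Nearer as b w = ∃[ a ] a ∈ as × d a w < d b w

    beats-both : ∀ {as b b′ w} → Nearer as b′ w → Nearer as b w → Beats as (b′ ∷ b ∷ []) w
    beats-both near′ near (here refl)         = near′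
    beats-both near′ near (there (here refl)) = near

    -- Each vertex of B is confined to its branch at `x`, whatever A plays in the second round.
    wins-from-balanced : ∀ {x} → (∀ {y} → Adj T x y → 3 * size x y < n) → WinsFrom x
    wins-from-balanced {x} light b b≢x with spare x b | toward (b≢x ∘ sym)
    ... | a′ , a′≢x , a′≢b | y , xy , b∈ = a′ , a′≢x , a′≢b , λ b′ b′≢x _ _ →
      let y′ , xy′ , b′∈ = toward (b′≢x ∘ sym)
          x∈ = there (here refl)
      in win-outside (branch? x y′) (branch? x y) x∈
           (λ w∉′ w∉ → beats-both (x , x∈ , base-separates xy′ b′∈ w∉′) (x , x∈ , base-separates xy b∈ w∉))
           (two-thirds (size x y′) (size x y) (light xy′) (<⇒≤ (light xy)))

    -- This is `base-separates` seen from the tip: `Branch x r` is the complement of `Branch r x`.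
    tip-guards : ∀ {r x b w} → Adj T x r → ¬ Branch r x b → Branch r x w → d x w < d b w
    tip-guards xr b∉ w∈ = base-separates xr (branch-flip (Adj-sym xr) b∉) (branch-exclusive w∈)

    child-of : ∀ {r x b} → Adj T x r → Branch r x b → b ≢ x → ∃[ y ] Adj T x y × y ≢ r × Branch x y b
    child-of xr b∈ b≢x with toward (b≢x ∘ sym)
    ... | y , xy , b∈y = y , xy , (λ { refl → branch-exclusive b∈ b∈y }) , b∈y

    -- Otherwise the branch is `x` alone, and being large it forces `n ≤ 3`, against `4≤n`.
    has-child : ∀ {r x} → Minimal r x → ∃[ y ] Adj T x y × y ≢ r
    has-child {r} {x} min with any? (λ w → branch? r x w ×-dec ¬? (w ≟ x))
    ... | yes (w , w∈ , w≢x) = let y , xy , y≢r , _ = child-of (Minimal.edge min) w∈ w≢x in y , xy , y≢r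
    ... | no ¬∃ = contradiction (≤-trans 4≤n (≤-trans (Minimal.large min)
                    (*-monoʳ-≤ 3 (card-unique (branch? r x) λ p q → trans (only p) (sym (only q)))))) (<⇒≱ ≤-refl)
      where
      only : ∀ {w} → Branch r x w → w ≡ x
      only {w} w∈ = decidable-stable (w ≟ x) λ w≢x → ¬∃ (w , w∈ , w≢x)

    module TwoTips {r x r′ x′} (min : Minimal r x) (min′ : Minimal r′ x′)
                   (J⊆ : ∀ {w} → Branch r′ x′ w → Branch x r w) where
      open Minimal min
      open Minimal min′ renaming (edge to edge′; large to large′; children to children′)

      I J Middle : Fin n → Set
      I = Branch r x
      J = Branch r′ x′
      Middle w = ¬ I w × ¬ J w

      middle? : Decidable Middle
      middle? w = ¬? (branch? r x w) ×-dec ¬? (branch? r′ x′ w)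

      I∩J=∅ : ∀ {w} → I w → ¬ J w
      I∩J=∅ w∈I w∈J = branch-exclusive w∈I (J⊆ w∈J)

      x∈I : I x
      x∈I = ∈branch-tip (Adj⇒≢ edge ∘ sym)

      x′∈J : J x′
      x′∈J = ∈branch-tip (Adj⇒≢ edge′ ∘ sym)

      x≢x′ : x ≢ x′
      x≢x′ refl = I∩J=∅ x∈I x′∈J

      3|I|+3|J|+3|M|≤3n : 3 * size r x + 3 * size r′ x′ + 3 * card middle? ≤ 3 * n
      3|I|+3|J|+3|M|≤3n = begin
        3 * size r x + 3 * size r′ x′ + 3 * card middle?
          ≡⟨ cong (_+ 3 * card middle?) (*-distribˡ-+ 3 (size r x) (size r′ x′)) ⟨
        3 * (size r x + size r′ x′) + 3 * card middle?
          ≡⟨ *-distribˡ-+ 3 (size r x + size r′ x′) (card middle?) ⟨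
        3 * (size r x + size r′ x′ + card middle?)
          ≡⟨ cong (λ k → 3 * (k + card middle?)) (∑-distrib-+ (λ w → ⟦ branch? r x w ⟧) (λ w → ⟦ branch? r′ x′ w ⟧)) ⟨
        3 * (sum (λ w → ⟦ branch? r x w ⟧ + ⟦ branch? r′ x′ w ⟧) + card middle?)
          ≡⟨ cong (3 *_) (∑-distrib-+ (λ w → ⟦ branch? r x w ⟧ + ⟦ branch? r′ x′ w ⟧) (λ w → ⟦ middle? w ⟧)) ⟨
        3 * sum (λ w → ⟦ branch? r x w ⟧ + ⟦ branch? r′ x′ w ⟧ + ⟦ middle? w ⟧)
          ≤⟨ *-monoʳ-≤ 3 (sum-mono (λ w → pointwise (branch? r x w) (branch? r′ x′ w) I∩J=∅)) ⟩
        3 * sum {n} (λ _ → 1)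
          ≡⟨ cong (3 *_) (card-all n) ⟩
        3 * n ∎
        where
        open ≤-Reasoning
        pointwise : {P Q : Set} (P? : Dec P) (Q? : Dec Q) → (P → ¬ Q) →
                    ⟦ P? ⟧ + ⟦ Q? ⟧ + ⟦ ¬? P? ×-dec ¬? Q? ⟧ ≤ 1
        pointwise (yes p) (yes q) disjoint = contradiction q (disjoint p)
        pointwise (yes p) (no  _) disjoint = ≤-refl
        pointwise (no  _) (yes q) disjoint = ≤-refl
        pointwise (no  _) (no  _) disjoint = ≤-refl

      3|M|≤n : 3 * card middle? ≤ n
      3|M|≤n = +-cancelˡ-≤ (n + n) _ _ (begin
        n + n + 3 * card middle?                          ≤⟨ +-monoˡ-≤ _ (+-mono-≤ large large′) ⟩
        3 * size r x + 3 * size r′ x′ + 3 * card middle?  ≤⟨ 3|I|+3|J|+3|M|≤3n ⟩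
        3 * n                                             ≡⟨ cong (λ k → n + (n + k)) (+-identityʳ n) ⟩
        n + (n + n)                                       ≡⟨ +-assoc n n n ⟨
        n + n + n                                         ∎)
        where open ≤-Reasoning

      module Both {as} (x∈ : x ∈ as) (x′∈ : x′ ∈ as) where

        -- A zone of `b` is a set of at most n/3 vertices outside which `x` or `x′` is nearer than
        -- `b`.
        data Zone (b : Fin n) : Set where
          middle : (∀ {w} → ¬ Middle w → Nearer as b w) → Zone b
          branch : ∀ p q → 3 * size p q < n → (∀ {w} → ¬ Branch p q w → Nearer as b w) → Zone b

        zone : ∀ {b} → b ≢ x → b ≢ x′ → Zone b
        zone {b} b≢x b≢x′ with branch? r x b | branch? r′ x′ b
        ... | yes b∈I | _ = let y , xy , y≢r , b∈ = child-of edge b∈I b≢x in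
          branch x y (children xy y≢r) λ w∉ → x , x∈ , base-separates xy b∈ w∉
        ... | no _ | yes b∈J = let y , xy , y≢r , b∈ = child-of edge′ b∈J b≢x′ in
          branch x′ y (children′ xy y≢r) λ w∉ → x′ , x′∈ , base-separates xy b∈ w∉
        ... | no b∉I | no b∉J = middle guarded
          where
          guarded : ∀ {w} → ¬ Middle w → Nearer as b w
          guarded {w} w∉M with branch? r x w | branch? r′ x′ w
          ... | yes w∈I | _       = x , x∈ , tip-guards edge b∉I w∈I
          ... | no  _   | yes w∈J = x′ , x′∈ , tip-guards edge′ b∉J w∈J
          ... | no  w∉I | no  w∉J = contradiction (w∉I , w∉J) w∉M

        zones-win : ∀ {b b′} → Zone b′ → Zone b → Won as (b′ ∷ b ∷ [])
        -- Both zones are the same set, which is counted once; twice its size could equal 2n/3,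
        -- where strictness fails.
        zones-win (middle g′) (middle g) = win-outside none? middle? x∈ (λ _ w∉ → beats-both (g′ w∉) (g w∉))
          (two-thirds (card {n} none?) (card middle?) (subst (λ k → 3 * k < n) (sym (card-none n)) 0<n) 3|M|≤n)
        zones-win (middle g′) (branch p q small g) = win-outside (branch? p q) middle? x∈
          (λ w∉ w∉′ → beats-both (g′ w∉′) (g w∉)) (two-thirds (size p q) (card middle?) small 3|M|≤n)
        zones-win (branch p q small g′) (middle g) = win-outside (branch? p q) middle? x∈
          (λ w∉′ w∉ → beats-both (g′ w∉′) (g w∉)) (two-thirds (size p q) (card middle?) small 3|M|≤n)
        zones-win (branch p q small g′) (branch s t small′ g) = win-outside (branch? p q) (branch? s t) x∈
          (λ w∉′ w∉ → beats-both (g′ w∉′) (g w∉)) (two-thirds (size p q) (size s t) small (<⇒≤ small′))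

        both-win : ∀ {b b′} → b ≢ x → b ≢ x′ → b′ ≢ x → b′ ≢ x′ → Won as (b′ ∷ b ∷ [])
        both-win b≢x b≢x′ b′≢x b′≢x′ = zones-win (zone b′≢x b′≢x′) (zone b≢x b≢x′)

      module _ {z} (xz : Adj T x z) (z≢r : z ≢ r)
               (largest : ∀ {y} → Adj T x y → y ≢ r → size x y ≤ size x z) where

        -- The reply `x′` is answered by `r′`, which confines `x′` to `J`. If `b′` enters `I`, B
        -- gets at most `J` and one child branch of `x`; if it does not, A holds all of `I` and also
        -- `r′`.
        wins-from-x : 3 * (size r′ x′ + size x z) < 2 * n → WinsFrom x
        wins-from-x bound b b≢x with b ≟ x′
        ... | no b≢x′ = x′ , x≢x′ ∘ sym , b≢x′ ∘ sym , λ b′ b′≢x b′≢x′ _ →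
          Both.both-win (there (here refl)) (here refl) b≢x b≢x′ b′≢x b′≢x′
        ... | yes refl = reply (r′ ≟ x)
          where
          r′-near : ∀ {w} → ¬ J w → d r′ w < d x′ w
          r′-near w∉J = base-separates (Adj-sym edge′) x′∈J w∉J

          beats-I : ∀ {as b′} → r′ ∈ as → x ∈ as → b′ ≢ x → I b′ → Won as (b′ ∷ x′ ∷ [])
          beats-I r′∈ x∈ b′≢x b′∈I = let y , xy , y≢r , b′∈ = child-of edge b′∈I b′≢x in
            win-outside (branch? r′ x′) (branch? x y) x∈
              (λ w∉J w∉ → beats-both (x , x∈ , base-separates xy b′∈ w∉) (r′ , r′∈ , r′-near w∉J))
              (≤-<-trans (*-monoʳ-≤ 3 (+-monoʳ-≤ (size r′ x′) (largest xy y≢r))) bound)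

          reply : Dec (r′ ≡ x) → ∃[ a′ ] a′ ≢ x × a′ ≢ x′ ×
            (∀ b′ → b′ ≢ x → b′ ≢ a′ → b′ ≢ x′ → Won (a′ ∷ x ∷ []) (b′ ∷ x′ ∷ []))
          reply (no r′≢x) = r′ , r′≢x , Adj⇒≢ edge′ ∘ sym , λ b′ b′≢x b′≢r′ _ → case b′ b′≢x b′≢r′ (branch? r x b′)
            where
            -- If `r′` were in `I`, then `x` would separate it from `x′` and be nearer to `r′` than
            -- its neighbour `x′` is, that is, at distance 0.
            r′∉I : ¬ I r′
            r′∉I r′∈I = r′≢x (sym (d≡0⇒≡ (n≤0⇒n≡0 (≤-pred (begin
              suc (d x r′)   ≤⟨ base-separates edge (J⊆ x′∈J) (branch-exclusive r′∈I) ⟩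
              d x′ r′        ≤⟨ d-step r′ edge′ ⟩
              suc (d r′ r′)  ≡⟨ cong suc (d-refl r′) ⟩
              1              ∎)))))
              where open ≤-Reasoning
            case : ∀ b′ → b′ ≢ x → b′ ≢ r′ → Dec (I b′) → Won (r′ ∷ x ∷ []) (b′ ∷ x′ ∷ [])
            case b′ b′≢x b′≢r′ (yes b′∈I) = beats-I (here refl) (there (here refl)) b′≢x b′∈I
            case b′ b′≢x b′≢r′ (no  b′∉I) = win-branch-and r′ (here refl) large r′∉I
              (beats-both (own b′≢r′) (own (Adj⇒≢ edge′)))
              λ w∈I → beats-both (x , there (here refl) , tip-guards edge b′∉I w∈I)
                                 (x , there (here refl) , tip-guards edge (λ x′∈I → I∩J=∅ x′∈I x′∈J) w∈I)
              where
              own : ∀ {b} → b ≢ r′ → Nearer (r′ ∷ x ∷ []) b r′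
              own b≢r′ = r′ , here refl , ∈branch-tip b≢r′
          -- Here `r′` is the vertex `x` that A owns already, so any free vertex serves as `a′`. The
          -- edge from `x` to `r` leads to `x′`, and `I` and `J` are complementary.
          reply (yes refl) with spare x x′
          ... | a′ , a′≢x , a′≢x′ = a′ , a′≢x , a′≢x′ , λ b′ b′≢x _ _ → case b′ b′≢x (branch? r x b′)
            where
            x∈ : x ∈ (a′ ∷ x ∷ [])
            x∈ = there (here refl)
            r≡x′ : r ≡ x′
            r≡x′ = near-neighbour-unique edge (Adj-sym edge′) (<⇒≤ (J⊆ x′∈J)) (<⇒≤ x′∈J)
            case : ∀ b′ → b′ ≢ x → Dec (I b′) → Won (a′ ∷ x ∷ []) (b′ ∷ x′ ∷ [])
            case b′ b′≢x (yes b′∈I) = beats-I x∈ x∈ b′≢x b′∈I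
            case b′ b′≢x (no  b′∉I) = win-outside (branch? r′ x′) none? x∈
              (λ w∉J _ → beats-both (x , x∈ , tip-guards edge b′∉I (branch-flip edge (subst (λ v → ¬ Branch x v _) (sym r≡x′) w∉J)))
                                    (x , x∈ , r′-near w∉J))
              (≤-<-trans (*-monoʳ-≤ 3 (+-monoʳ-≤ (size r′ x′) (≤-trans (≤-reflexive (card-none n)) z≤n))) bound)

        -- The reply `x` is answered by `z`. If `b′` stays out of `J`, A holds `J` and also `z`. If
        -- it enters a child branch at `x′`, A still holds the rest of `J` together with
        -- `Branch x z`, and by `bound` the loss of fewer than n/3 vertices is affordable.
        wins-from-x′ : 2 * n ≤ 3 * (size r′ x′ + size x z) → WinsFrom x′
        wins-from-x′ bound b b≢x′ with b ≟ x
        ... | no b≢x = x , x≢x′ , b≢x ∘ sym , λ b′ b′≢x′ b′≢x _ →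
          Both.both-win (here refl) (there (here refl)) b≢x b≢x′ b′≢x b′≢x′
        ... | yes refl = z , z≢x′ , Adj⇒≢ xz ∘ sym , λ b′ b′≢x′ b′≢z _ → case b′≢x′ b′≢z (branch? r′ x′ b′)
          where
          as : List (Fin n)
          as = z ∷ x′ ∷ []
          z∈ : Branch x z z
          z∈ = ∈branch-tip (Adj⇒≢ xz)
          Z∩J=∅ : ∀ {w} → Branch x z w → ¬ J w
          Z∩J=∅ w∈Z = I∩J=∅ (child⊆ xz edge z≢r w∈Z)
          z≢x′ : z ≢ x′
          z≢x′ refl = Z∩J=∅ z∈ x′∈J
          x′-beats-x : ∀ {w} → J w → Nearer as x w
          x′-beats-x w∈J = x′ , there (here refl) , tip-guards edge′ (I∩J=∅ x∈I) w∈J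
          case : ∀ {b′} → b′ ≢ x′ → b′ ≢ z → Dec (J b′) → Won as (b′ ∷ x ∷ [])
          case b′≢x′ b′≢z (no b′∉J) = win-branch-and z (here refl) large′ (Z∩J=∅ z∈)
            (beats-both (z , here refl , ∈branch-tip b′≢z) (z , here refl , z∈))
            λ w∈J → beats-both (x′ , there (here refl) , tip-guards edge′ b′∉J w∈J) (x′-beats-x w∈J)
          case {b′} b′≢x′ b′≢z (yes b′∈J) with child-of edge′ b′∈J b′≢x′
          ... | y , xy , y≢r′ , b′∈ = win-on (branch? r′ x′) (branch? x z) (branch? x′ y) none? (here refl)
            (λ w∈J w∈Z → Z∩J=∅ w∈Z w∈J)
            (λ { (inj₁ w∈J) w∉ _ → beats-both (x′ , there (here refl) , base-separates xy b′∈ w∉) (x′-beats-x w∈J)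
               ; (inj₂ w∈Z) _ _ → beats-both
                   (z , here refl , tip-guards (Adj-sym xz) (λ b′∈Z → Z∩J=∅ b′∈Z b′∈J) w∈Z) (z , here refl , w∈Z) })
            (begin-strict
              n + 3 * (size x′ y + card {n} none?)   ≡⟨ cong (λ k → n + 3 * (size x′ y + k)) (card-none n) ⟩
              n + 3 * (size x′ y + 0)        ≡⟨ cong (λ k → n + 3 * k) (+-identityʳ (size x′ y)) ⟩
              n + 3 * size x′ y              <⟨ +-monoʳ-< n (children′ xy y≢r′) ⟩
              n + n                          ≡⟨ 2*≡+ n ⟨
              2 * n                          ≤⟨ bound ⟩
              3 * (size r′ x′ + size x z)    ∎)
            where open ≤-Reasoning

    -- The two sides of an edge add up to `n`, so they cannot both be below n/3.
    first-edge : ∀ {u v} → u ≢ v → ∃[ r ] ∃[ x ] Adj T x r × n ≤ 3 * size r x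
    first-edge {u} u≢v with toward u≢v
    ... | w , uw , _ with n ≤? 3 * size u w | n ≤? 3 * size w u
    ...   | yes large | _         = u , w , Adj-sym uw , large
    ...   | no  _     | yes large = w , u , uw , large
    ...   | no  small | no small′ = contradiction (size-complement uw) (<⇒≢ (*-cancelˡ-< 3 _ _ (begin-strict
      3 * (size u w + size w u)    <⟨ two-thirds (size u w) (size w u) (≰⇒> small) (<⇒≤ (≰⇒> small′)) ⟩
      2 * n                        ≤⟨ *-monoˡ-≤ n (n≤1+n 2) ⟩
      3 * n                        ∎)))
      where open ≤-Reasoning

    two-rounds : Win (gameA T 2 [] [])
    two-rounds with first-edge {fromℕ< 0<n} {fromℕ< (≤-trans (s≤s (s≤s z≤n)) 4≤n)} (λ eq →
      0≢1+n (trans (sym (toℕ-fromℕ< 0<n)) (trans (cong toℕ eq) (toℕ-fromℕ< _))))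
    ... | _ , _ , e , lrg with minimal-below e lrg
    ...   | r , x , min , _ with n ≤? 3 * size x r
    ...     | no small = wins (wins-from-balanced light)
      where
      light : ∀ {y} → Adj T x y → 3 * size x y < n
      light {y} xy with y ≟ r
      ... | yes refl = ≰⇒> small
      ... | no y≢r   = Minimal.children min xy y≢r
    ...     | yes lrg′ with minimal-below (Adj-sym (Minimal.edge min)) lrg′
                        | argmax (λ y → adj? x y ×-dec ¬? (y ≟ r)) (size x) (has-child min)
    -- The opening `x` is chosen if J and the largest child branch at `x` have fewer than 2n/3
    -- vertices together, the opening `x′` otherwise.
    ...       | r′ , x′ , min′ , J⊆ | z , (xz , z≢r) , max with 2 * n ≤? 3 * (size r′ x′ + size x z)
    ...         | yes big = wins (TwoTips.wins-from-x′ min min′ J⊆ xz z≢r (λ xy y≢r → max (xy , y≢r)) big)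
    ...         | no ¬big = wins (TwoTips.wins-from-x min min′ J⊆ xz z≢r (λ xy y≢r → max (xy , y≢r)) (≰⇒> ¬big))

  -- Trees given by a parent function

  module ParentTree {n : ℕ} (parent : Fin n → Fin n) (depth : Fin n → ℕ) (root : Fin n)
                    (depth≡0⇒root : ∀ {u} → depth u ≡ 0 → u ≡ root)
                    (depth-parent : ∀ {u k} → depth u ≡ suc k → depth (parent u) ≡ k) where

    -- `parent` is a total function and has some value at the root too; the condition on the depths
    -- excludes an upward edge there.
    Up : Fin n → Fin n → Set
    Up u v = depth u ≡ suc (depth v) × parent u ≡ v

    up? : ∀ u v → Dec (Up u v)
    up? u v = (depth u ℕ.≟ suc (depth v)) ×-dec (parent u ≟ v)

    link? : ∀ u v → Dec (Up u v ⊎ Up v u)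
    link? u v = up? u v ⊎-dec up? v u

    tree : Graph n
    tree = record
      { adj     = λ u v → does (link? u v)
      ; adj-sym = λ u v → does-⇔ (mk⇔ swap swap) (link? u v) (link? v u)
      ; irrefl  = λ v → dec-false (link? v v) λ { (inj₁ (eq , _)) → 1+n≢n (sym eq) ; (inj₂ (eq , _)) → 1+n≢n (sym eq) }
      }

    open Paths tree

    adj⇒link : ∀ {u v} → Adj tree u v → Up u v ⊎ Up v u
    adj⇒link {u} {v} uv = does⇒ (link? u v) uv
      where
      does⇒ : {P : Set} (P? : Dec P) → does P? ≡ true → P
      does⇒ (yes p) _ = p

    up⇒adj : ∀ {u v} → Up u v → Adj tree u v
    up⇒adj {u} {v} up = dec-true (link? u v) (inj₁ up)

    climb : ∀ k u → depth u ≡ k → WalkIn (λ _ → ⊤) u root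
    climb zero    u eq with refl ← depth≡0⇒root eq = done tt
    climb (suc k) u eq = move tt (up⇒adj (trans eq (cong suc (sym (depth-parent eq))) , refl))
                                (climb k (parent u) (depth-parent eq))

    toWalk : ∀ {u v} → WalkIn (λ _ → ⊤) u v → Walk tree u v
    toWalk (done _)     = here
    toWalk (move _ e w) = step e (toWalk w)

    connected : Connected tree
    connected u v = toWalk (WalkIn-trans (climb _ u refl) (WalkIn-sym (climb _ v refl)))

    -- Trail a b y z: a walk without backtracking whose first step is a → b and whose last step is y → z.
    data Trail : Fin n → Fin n → Fin n → Fin n → Set where
      edge : ∀ {a b} → Adj tree a b → Trail a b a b
      _∷_  : ∀ {a b c y z} → Adj tree a b × a ≢ c → Trail b c y z → Trail a b y z

    first-step : ∀ {a b y z} → Trail a b y z → Adj tree a b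
    first-step (edge ab)      = ab
    first-step ((ab , _) ∷ _) = ab

    -- After a step down a trail can never go up again.
    down : ∀ {a b y z} → Trail a b y z → Up b a → depth a < depth z × Up z y
    down (edge _) up@(eq , _) = ≤-reflexive (sym eq) , up
    down ((_ , a≢c) ∷ t) (eq , refl) with adj⇒link (first-step t)
    ... | inj₁ (_ , refl) = contradiction refl a≢c
    ... | inj₂ up         = let lt , last = down t up in <-trans (≤-reflexive (sym eq)) lt , last

    -- Either the trail climbs to its end, or it turns once, and from then on `down` governs it.
    up-then-down : ∀ {a b y z} → Trail a b y z → Up a b → depth z < depth a ⊎ Up z y
    up-then-down (edge _) (eq , _) = inj₁ (≤-reflexive (sym eq))
    up-then-down (_ ∷ t) (eq , _) with adj⇒link (first-step t)
    ... | inj₂ up = inj₂ (proj₂ (down t up))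
    ... | inj₁ up with up-then-down t up
    ...   | inj₁ lt   = inj₁ (<-trans lt (≤-reflexive (sym eq)))
    ...   | inj₂ last = inj₂ last

    -- Depth rules out a return to `v` by descending only or climbing only. Otherwise the first step
    -- goes up to the parent of `v` and the last comes down from it, so `b` and `y` coincide.
    no-closed-trail : ∀ {v b y} → b ≢ y → ¬ Trail v b y v
    no-closed-trail b≢y t with adj⇒link (first-step t)
    ... | inj₂ up = <-irrefl refl (proj₁ (down t up))
    ... | inj₁ up with up-then-down t up
    ...   | inj₁ lt   = <-irrefl refl lt
    ...   | inj₂ last = b≢y (trans (sym (proj₂ up)) (proj₂ last))

    -- Distinct vertices on the cycle exclude backtracking. The membership of `y` lets `acyclic`
    -- tell the last vertex before `v` from the first one after it.
    trail : ∀ {v a b} xs → All (v ≢_) (a ∷ b ∷ xs) → Unique (a ∷ b ∷ xs) →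
            Linked (Adj tree) (a ∷ b ∷ xs ++ v ∷ []) → ∃[ y ] y ∈ b ∷ xs × Trail a b y v
    trail [] (v≢a ∷ _) _ (ab ∷ bv ∷ _) = _ , here refl , (ab , v≢a ∘ sym) ∷ edge bv
    trail (c ∷ xs) (_ ∷ v≢) ((_ ∷ a≢c ∷ _) ∷ u) (ab ∷ l) =
      let y , y∈ , t = trail xs v≢ u l in y , there y∈ , (ab , a≢c) ∷ t

    acyclic : ¬ Cycle tree
    acyclic (v , b ∷ [] , s≤s () , _)
    acyclic (v , b ∷ c ∷ xs , _ , v≢@(_ ∷ v≢c ∷ _) ∷ u@(b∉ ∷ _) , vb ∷ l) =
      let y , y∈ , t = trail xs v≢ u l in no-closed-trail (All.lookup b∉ y∈) ((vb , v≢c) ∷ t)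

    isTree : IsTree tree
    isTree = connected , acyclic

  -- The tripod and its distances

  module Lipschitz {n : ℕ} (G : Graph n) (connected : Connected G) where
    open Distance G connected

    -- Along a geodesic to `x` the function `f` drops by at most 1 per step. Lower bounds for
    -- distances in the tripod thus follow from an explicit formula checked on edges.
    lipschitz⇒≤d : ∀ {x} (f : Fin n → ℕ) → f x ≡ 0 → (∀ {u v} → Adj G u v → f u ≤ suc (f v)) → ∀ u → f u ≤ d u x
    lipschitz⇒≤d {x} f fx≡0 lip u = go (d u x) u refl
      where
      go : ∀ k u → d u x ≡ k → f u ≤ k
      go k u eq with u ≟ x
      ... | yes refl = ≤-trans (≤-reflexive fx≡0) z≤n
      ... | no u≢x with closer-neighbour u≢x
      go zero    u eq | no _ | _ , _ , lt = contradiction (trans lt eq) λ ()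
      go (suc k) u eq | no _ | v , uv , lt = ≤-trans (lip uv) (s≤s (go k v (suc-injective (trans lt eq))))

  sum-+ : ∀ m {n} (f : Fin (m + n) → ℕ) → sum f ≡ sum (λ i → f (i ↑ˡ n)) + sum (λ j → f (m ↑ʳ j))
  sum-+ zero    f = refl
  sum-+ (suc m) f = trans (cong (f zero +_) (sum-+ m (f ∘ suc))) (sym (+-assoc (f zero) _ _))

  sum-* : ∀ m {n} (f : Fin (m * n) → ℕ) → sum f ≡ sum (λ i → sum (λ j → f (combine {m} i j)))
  sum-* zero        f = refl
  sum-* (suc m) {n} f = trans (sum-+ n f) (cong (sum (λ j → f (j ↑ˡ (m * n))) +_) (sum-* m (λ k → f (n ↑ʳ k))))

  ∣n-1+n∣≡1 : ∀ n → ∣ n - suc n ∣ ≡ 1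
  ∣n-1+n∣≡1 zero    = refl
  ∣n-1+n∣≡1 (suc n) = ∣n-1+n∣≡1 n

  ∣suc-∣≤ : ∀ p h → ∣ suc p - h ∣ ≤ suc ∣ p - h ∣
  ∣suc-∣≤ p h = ≤-trans (∣-∣-triangle (suc p) p h)
    (+-monoˡ-≤ _ (≤-reflexive (trans (∣-∣-comm (suc p) p) (∣n-1+n∣≡1 p))))

  ∣-∣≤suc : ∀ p h → ∣ p - h ∣ ≤ suc ∣ suc p - h ∣
  ∣-∣≤suc p h = ≤-trans (∣-∣-triangle p (suc p) h) (+-monoˡ-≤ _ (≤-reflexive (∣n-1+n∣≡1 p)))

  -- Three legs of length P = 3 ^ N + 1 leave the root, each carrying N clusters of M leaves.
  -- On legs 0 and 1 the clusters hang at the distances 3 ^ i from the root, on leg 2 they all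
  -- hang at distance 1.
  module Tripod (N M : ℕ) where

    P : ℕ
    P = suc (3 ^ N)

    order : ℕ
    order = suc (3 * (P + N * M))

    data Node : Set where
      root  : Node
      spine : Fin 3 → Fin P → Node
      leaf  : Fin 3 → Fin N → Fin M → Node

    -- The arithmetic of the numbering is sealed: later arguments see only the bijection with `Node`
    -- and the splitting of sums in `sum-nodes`.
    abstract
      encode : Node → Fin order
      encode root         = zero
      encode (spine τ p)  = suc (combine τ (p ↑ˡ (N * M)))
      encode (leaf τ i m) = suc (combine τ (P ↑ʳ combine i m))

      decodeLeg : Fin 3 → Fin P ⊎ Fin (N * M) → Node
      decodeLeg τ (inj₁ p) = spine τ p
      decodeLeg τ (inj₂ l) = leaf τ (proj₁ (remQuot M l)) (proj₂ (remQuot {N} M l))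

      decodePair : Fin 3 × Fin (P + N * M) → Node
      decodePair (τ , j) = decodeLeg τ (splitAt P j)

      decode : Fin order → Node
      decode zero    = root
      decode (suc k) = decodePair (remQuot {3} (P + N * M) k)

      decode-encode : ∀ v → decode (encode v) ≡ v
      decode-encode root = refl
      decode-encode (spine τ p) = trans (cong decodePair (remQuot-combine {3} τ (p ↑ˡ (N * M))))
        (cong (decodeLeg τ) (splitAt-↑ˡ P p (N * M)))
      decode-encode (leaf τ i m) = trans (cong decodePair (remQuot-combine {3} τ (P ↑ʳ combine i m)))
        (trans (cong (decodeLeg τ) (splitAt-↑ʳ P (N * M) (combine i m)))
               (cong (λ im → leaf τ (proj₁ im) (proj₂ im)) (remQuot-combine {N} i m)))

      encode-decodeLeg : ∀ τ s → encode (decodeLeg τ s) ≡ suc (combine τ (join P (N * M) s))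
      encode-decodeLeg τ (inj₁ p) = refl
      encode-decodeLeg τ (inj₂ l) = cong (λ k → suc (combine τ (P ↑ʳ k))) (combine-remQuot {N} M l)

      encode-decodePair : ∀ s → encode (decodePair s) ≡ suc (combine (proj₁ s) (proj₂ s))
      encode-decodePair (τ , j) = trans (encode-decodeLeg τ (splitAt P j))
        (cong (λ k → suc (combine τ k)) (join-splitAt P (N * M) j))

      encode-decode : ∀ v → encode (decode v) ≡ v
      encode-decode zero    = refl
      encode-decode (suc k) = trans (encode-decodePair (remQuot {3} (P + N * M) k))
        (cong suc (combine-remQuot {3} (P + N * M) k))

      sum-nodes : ∀ (f : Fin order → ℕ) → sum f ≡
        f (encode root) + sum (λ τ → sum (λ p → f (encode (spine τ p))) + sum (λ i → sum (λ m → f (encode (leaf τ i m)))))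
      sum-nodes f = cong (f zero +_) (trans (sum-* 3 {P + N * M} (f ∘ suc)) (sum-cong-≗ λ τ →
        trans (sum-+ P (λ j → f (suc (combine {3} τ j)))) (cong (sum (λ p → f (encode (spine τ p))) +_)
          (sum-* N {M} (λ l → f (suc (combine {3} τ (P ↑ʳ l))))))))

    hub : Fin 3 → Fin N → ℕ
    hub 0F i = 3 ^ toℕ i
    hub 1F i = 3 ^ toℕ i
    hub 2F i = 1

    -- The root is assigned to leg 0 with position 0.
    side : Node → Fin 3
    side root         = 0F
    side (spine τ _)  = τ
    side (leaf τ _ _) = τ

    pos : Node → ℕ
    pos root         = 0
    pos (spine _ p)  = suc (toℕ p)
    pos (leaf τ i _) = hub τ i

    off : Node → ℕ
    off (leaf _ _ _) = 1
    off _            = 0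

    -- Truncation makes `spineAt` total; the lemmas on its position assume `q ≤ P`.
    clamp : ℕ → Fin P
    clamp q = fromℕ< (s≤s (m⊓n≤n q (3 ^ N)))

    toℕ-clamp : ∀ {q} → q < P → toℕ (clamp q) ≡ q
    toℕ-clamp (s≤s q≤) = trans (toℕ-fromℕ< _) (m≤n⇒m⊓n≡m q≤)

    spineAt : Fin 3 → ℕ → Node
    spineAt τ zero    = root
    spineAt τ (suc q) = spine τ (clamp q)

    clamp-toℕ : ∀ (p : Fin P) → clamp (toℕ p) ≡ p
    clamp-toℕ p = toℕ-injective (toℕ-clamp (toℕ<n p))

    parentNode : Node → Node
    parentNode root         = root
    parentNode (spine τ p)  = spineAt τ (toℕ p)
    parentNode (leaf τ i m) = spineAt τ (hub τ i)

    1≤3^ : ∀ k → 1 ≤ 3 ^ k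
    1≤3^ k = m^n>0 3 k

    hub>0 : ∀ τ i → 0 < hub τ i
    hub>0 0F i = 1≤3^ (toℕ i)
    hub>0 1F i = 1≤3^ (toℕ i)
    hub>0 2F i = ≤-refl

    hub≤P : ∀ τ i → hub τ i ≤ P
    hub≤P 0F i = ≤-trans (^-monoʳ-≤ 3 (<⇒≤ (toℕ<n i))) (n≤1+n _)
    hub≤P 1F i = ≤-trans (^-monoʳ-≤ 3 (<⇒≤ (toℕ<n i))) (n≤1+n _)
    hub≤P 2F i = s≤s z≤n

    pos-spineAt : ∀ τ {q} → q ≤ P → pos (spineAt τ q) ≡ q
    pos-spineAt τ {zero}  _  = refl
    pos-spineAt τ {suc q} q< = cong suc (toℕ-clamp q<)

    off-spineAt : ∀ τ q → off (spineAt τ q) ≡ 0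
    off-spineAt τ zero    = refl
    off-spineAt τ (suc q) = refl

    depthNode : Node → ℕ
    depthNode v = pos v + off v

    depth-spineAt : ∀ τ {q} → q ≤ P → depthNode (spineAt τ q) ≡ q
    depth-spineAt τ {q} q≤ = trans (cong₂ _+_ (pos-spineAt τ q≤) (off-spineAt τ q)) (+-identityʳ q)

    depthNode-parent : ∀ v {k} → depthNode v ≡ suc k → depthNode (parentNode v) ≡ k
    depthNode-parent (spine τ p)  eq = trans (depth-spineAt τ (<⇒≤ (toℕ<n p)))
      (trans (sym (+-identityʳ (toℕ p))) (suc-injective eq))
    depthNode-parent (leaf τ i m) eq = trans (depth-spineAt τ (hub≤P τ i))
      (suc-injective (trans (+-comm 1 (hub τ i)) eq))

    pos≡0⇒root : ∀ v → pos v ≡ 0 → v ≡ root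
    pos≡0⇒root root         _  = refl
    pos≡0⇒root (leaf τ i m) eq = contradiction (subst (0 <_) eq (hub>0 τ i)) λ ()

    depth≡0⇒root : ∀ {u} → depthNode (decode u) ≡ 0 → u ≡ encode root
    depth≡0⇒root {u} eq = trans (sym (encode-decode u)) (cong encode (pos≡0⇒root (decode u) (m+n≡0⇒m≡0 _ eq)))

    depth-parent : ∀ {u k} → depthNode (decode u) ≡ suc k → depthNode (decode (encode (parentNode (decode u)))) ≡ k
    depth-parent {u} eq = trans (cong depthNode (decode-encode _)) (depthNode-parent (decode u) eq)

    open ParentTree {order} (λ u → encode (parentNode (decode u))) (λ u → depthNode (decode u)) (encode root)
      (λ {u} → depth≡0⇒root {u}) (λ {u} → depth-parent {u}) public
    open Score tree connected public

    sp : Fin 3 → ℕ → Fin order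
    sp τ q = encode (spineAt τ q)

    lf : Fin 3 → Fin N → Fin M → Fin order
    lf τ i m = encode (leaf τ i m)

    up-node : ∀ v {k} → depthNode v ≡ suc k → Up (encode v) (encode (parentNode v))
    up-node v {k} eq rewrite decode-encode v | decode-encode (parentNode v) =
      trans eq (cong suc (sym (depthNode-parent v eq))) , refl

    spine-adj : ∀ τ {q} → q < P → Adj tree (sp τ q) (sp τ (suc q))
    spine-adj τ {q} q<P = Adj-sym {sp τ (suc q)} {sp τ q} (subst (λ k → Adj tree (sp τ (suc q)) (sp τ k)) (toℕ-clamp q<P)
      (up⇒adj {sp τ (suc q)} {sp τ (toℕ (clamp q))} (up-node (spine τ (clamp q)) refl)))

    leaf-adj : ∀ τ i m → Adj tree (sp τ (hub τ i)) (lf τ i m)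
    leaf-adj τ i m = Adj-sym {lf τ i m} {sp τ (hub τ i)} (up⇒adj {lf τ i m} {sp τ (hub τ i)} (up-node (leaf τ i m) (+-comm (hub τ i) 1)))

    d-spine-leaf : ∀ τ i m {q} k → q + k ≡ hub τ i → d (sp τ q) (lf τ i m) ≤ suc k
    d-spine-leaf τ i m {q} zero eq rewrite +-identityʳ q | eq =
      ≤-trans (d-step (lf τ i m) (leaf-adj τ i m)) (≤-reflexive (cong suc (d-refl (lf τ i m))))
    d-spine-leaf τ i m {q} (suc k) eq =
      ≤-trans (d-step (lf τ i m) (spine-adj τ (≤-trans (≤-trans (m≤m+n (suc q) k) (≤-reflexive eq′)) (hub≤P τ i))))
              (s≤s (d-spine-leaf τ i m k eq′))
      where
      eq′ : suc q + k ≡ hub τ i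
      eq′ = trans (sym (+-suc q k)) eq

    -- The distance between spine positions `p` and `h`: along the leg if it is the same one,
    -- through the root otherwise.
    gapAt : ∀ {P : Set} → Dec P → ℕ → ℕ → ℕ
    gapAt (yes _) p h = ∣ p - h ∣
    gapAt (no  _) p h = p + h

    gap : Fin 3 → ℕ → Node → ℕ
    gap τ h v = gapAt (side v ≟ τ) (pos v) h

    -- At position 0 both formulas of `gapAt` give `h`, so the leg to which the root is assigned
    -- does not matter.
    gap-spineAt : ∀ τ h σ {q} → q ≤ P → gap τ h (spineAt σ q) ≡ gapAt (σ ≟ τ) q h
    gap-spineAt τ h σ {suc q} q<P = cong (λ k → gapAt (σ ≟ τ) (suc k) h) (toℕ-clamp q<P)
    gap-spineAt τ h σ {zero}  _ with 0F ≟ τ | σ ≟ τ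
    ... | yes _ | yes _ = refl
    ... | yes _ | no  _ = refl
    ... | no  _ | yes _ = refl
    ... | no  _ | no  _ = refl

    gapAt-suc : ∀ {P : Set} (P? : Dec P) p h → gapAt P? (suc p) h ≤ suc (gapAt P? p h)
    gapAt-suc (yes _) p h = ∣suc-∣≤ p h
    gapAt-suc (no  _) p h = ≤-refl

    gapAt-pred : ∀ {P : Set} (P? : Dec P) p h → gapAt P? p h ≤ suc (gapAt P? (suc p) h)
    gapAt-pred (yes _) p h = ∣-∣≤suc p h
    gapAt-pred (no  _) p h = ≤-trans (n≤1+n _) (n≤1+n _)

  -- Clusters that B protects

  ⟦⊎⟧≤ : {P Q : Set} (P? : Dec P) (Q? : Dec Q) → ⟦ P? ⊎-dec Q? ⟧ ≤ ⟦ P? ⟧ + ⟦ Q? ⟧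
  ⟦⊎⟧≤ (yes _) Q?      = s≤s z≤n
  ⟦⊎⟧≤ (no  _) (yes _) = ≤-refl
  ⟦⊎⟧≤ (no  _) (no  _) = ≤-refl

  card-∈≤length : ∀ {n} (xs : List (Fin n)) → sum (λ v → ⟦ v ∈? xs ⟧) ≤ length xs
  card-∈≤length {n} []       = ≤-reflexive (trans (sum-const n 0) (*-zeroʳ n))
  card-∈≤length {n} (x ∷ xs) = begin
    sum (λ v → ⟦ v ∈? (x ∷ xs) ⟧)                ≤⟨ sum-mono (λ v → ⟦⊎⟧≤ (v ≟ x) (v ∈? xs)) ⟩
    sum (λ v → ⟦ v ≟ x ⟧ + ⟦ v ∈? xs ⟧)          ≡⟨ ∑-distrib-+ (λ v → ⟦ v ≟ x ⟧) (λ v → ⟦ v ∈? xs ⟧) ⟩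
    card (_≟ x) + sum (λ v → ⟦ v ∈? xs ⟧)        ≤⟨ +-mono-≤ (card-unique (_≟ x) (λ p q → trans p (sym q))) (card-∈≤length xs) ⟩
    suc (length xs)                              ∎
    where open ≤-Reasoning

  module Clusters (N M : ℕ) where
    open Tripod N M public

    posF : Fin order → ℕ
    posF u = pos (decode u)

    sideF : Fin order → Fin 3
    sideF u = side (decode u)

    root! : Fin order
    root! = encode root

    posF-sp : ∀ τ {q} → q ≤ P → posF (sp τ q) ≡ q
    posF-sp τ {q} q≤ = trans (cong pos (decode-encode (spineAt τ q))) (pos-spineAt τ q≤)

    sideF-sp : ∀ τ q → sideF (sp τ (suc q)) ≡ τ
    sideF-sp τ q = cong side (decode-encode (spineAt τ (suc q)))

    posF≡0⇒root : ∀ {u} → posF u ≡ 0 → u ≡ root!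
    posF≡0⇒root {u} eq = trans (sym (encode-decode u)) (cong encode (pos≡0⇒root (decode u) eq))

    on-spine : ∀ v {q} → off v ≡ 0 → pos v ≡ suc q → v ≡ spineAt (side v) (suc q)
    on-spine (spine τ p) _ refl = cong (spine τ) (sym (clamp-toℕ p))

    module ToLeaf (τ : Fin 3) (i : Fin N) (m : Fin M) where

      x : Fin order
      x = lf τ i m

      h : ℕ
      h = hub τ i

      -- The distance to x of a node other than x, up to the final 1.
      far : Node → ℕ
      far v = off v + gap τ h v

      potentialAt : {P : Set} → Dec P → Node → ℕ
      potentialAt (yes _) v = 0
      potentialAt (no  _) v = suc (far v)

      potential : Fin order → ℕ
      potential u = potentialAt (u ≟ x) (decode u)

      far-spineAt : ∀ σ {q} → q ≤ P → far (spineAt σ q) ≡ gapAt (σ ≟ τ) q h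
      far-spineAt σ {q} q≤ = cong₂ _+_ (off-spineAt σ q) (gap-spineAt τ h σ q≤)

      far-step : ∀ v {k} → depthNode v ≡ suc k → far v ≤ suc (far (parentNode v)) × far (parentNode v) ≤ suc (far v)
      far-step (spine σ p) _ rewrite far-spineAt σ (<⇒≤ (toℕ<n p)) =
        gapAt-suc (σ ≟ τ) (toℕ p) h , gapAt-pred (σ ≟ τ) (toℕ p) h
      far-step (leaf σ j _) _ rewrite far-spineAt σ (hub≤P σ j) = ≤-refl , ≤-trans (n≤1+n _) (n≤1+n _)

      far-x : far (parentNode (leaf τ i m)) ≡ 0
      far-x = trans (far-spineAt τ (hub≤P τ i)) (at-hub (τ ≟ τ))
        where
        at-hub : (d : Dec (τ ≡ τ)) → gapAt d h h ≡ 0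
        at-hub (yes _) = ∣n-n∣≡0 h
        at-hub (no ¬p) = contradiction refl ¬p

      spineAt≢leaf : ∀ σ q → spineAt σ q ≢ leaf τ i m
      spineAt≢leaf σ zero    ()
      spineAt≢leaf σ (suc q) ()

      parent≢leaf : ∀ v → parentNode v ≢ leaf τ i m
      parent≢leaf root         ()
      parent≢leaf (spine σ p)  = spineAt≢leaf σ (toℕ p)
      parent≢leaf (leaf σ j _) = spineAt≢leaf σ (hub σ j)

      potential-step : ∀ {u v} → Up u v → potential u ≤ suc (potential v) × potential v ≤ suc (potential u)
      potential-step {u} {v} (du , pu) with u ≟ x | v ≟ x | decode v | trans (cong decode (sym pu)) (decode-encode _)
      -- The upper end of an edge cannot be `x`, since no leaf is a parent.
      ... | _     | yes refl | _ | _ =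
        contradiction (trans (sym (decode-encode _)) (trans (cong decode pu) (decode-encode _))) (parent≢leaf (decode u))
      ... | no _  | no _ | _ | refl = let ≤₁ , ≤₂ = far-step (decode u) du in s≤s ≤₁ , s≤s ≤₂
      ... | yes refl | no _ | _ | refl = z≤n , s≤s (≤-reflexive (trans (cong (λ w → far (parentNode w)) (decode-encode _)) far-x))

      potential-lipschitz : ∀ {u v} → Adj tree u v → potential u ≤ suc (potential v)
      potential-lipschitz {u} {v} uv with adj⇒link {u} {v} uv
      ... | inj₁ up = proj₁ (potential-step up)
      ... | inj₂ up = proj₂ (potential-step up)

      potential-x : potential x ≡ 0
      potential-x with x ≟ x
      ... | yes _ = refl
      ... | no ¬p = contradiction refl ¬p

      d-lower : ∀ {a} → a ≢ x → suc (far (decode a)) ≤ d a x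
      d-lower {a} a≢x with a ≟ x | Lipschitz.lipschitz⇒≤d tree connected {x} potential potential-x (λ {u} {v} → potential-lipschitz {u} {v}) a
      ... | yes a≡x | _  = contradiction a≡x a≢x
      ... | no  _   | le = le

    -- Positivity excludes the root, which `side` assigns to leg 0 by convention.
    On : Fin 3 → Fin order → Set
    On τ a = sideF a ≡ τ × 0 < posF a

    -- A vertex of A at position z of leg τ then wins no cluster beyond z, unless A has claimed its hub.
    Blocked : Fin 3 → ℕ → List (Fin order) → List (Fin order) → Set
    Blocked τ z as bs = ∀ {p} → z < p → p ≤ P → (∃[ q ] z < q × q ≤ p × sp τ q ∈ bs) ⊎ sp τ p ∈ as

    -- `root! ∉ as` matters when B relies on the root: a vertex of A there would tie with it.
    record Guard (τ : Fin 3) (as bs : List (Fin order)) : Set where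
      field
        base   : (root! ∈ bs × root! ∉ as) ⊎ sp τ 1 ∈ bs
        blocks : ∀ {a} → a ∈ as → On τ a → Blocked τ (posF a) as bs

    -- Beyond twice the hub's position a vertex is farther from the hub than the root is, so only
    -- this interval endangers a guarded cluster. For hubs at powers of 3 the intervals are
    -- disjoint.
    Hit : Fin 3 → Fin N → Fin order → Set
    Hit τ i a = τ ≢ 2F × sideF a ≡ τ × hub τ i ≤ posF a × posF a ≤ 2 * hub τ i

    hit? : ∀ τ i a → Dec (Hit τ i a)
    hit? τ i a = ¬? (τ ≟ 2F) ×-dec (sideF a ≟ τ) ×-dec (hub τ i ≤? posF a) ×-dec (posF a ≤? 2 * hub τ i)

    anyHit? : ∀ as τ i → Dec (Any (Hit τ i) as)
    anyHit? as τ i = Any.any? (hit? τ i) as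

    Protected : Fin 3 → List (Fin order) → List (Fin order) → Set
    Protected τ as bs = ∀ i m → lf τ i m ∉ as → ¬ Any (Hit τ i) as → Beats bs as (lf τ i m)

    -- Distances to the hub are compared. A vertex of A on another leg or beyond `2 * h` is farther
    -- from it than the root; at the root it is farther than `sp τ 1`; short of the hub, a blocking
    -- vertex of B lies closer.
    guarded-leaf : ∀ {τ as bs} i m → Guard τ as bs → lf τ i m ∉ as →
                   (∀ {a} → a ∈ as → sideF a ≡ τ → hub τ i ≤ posF a → 2 * hub τ i < posF a) →
                   Beats bs as (lf τ i m)
    guarded-leaf {τ} {as} {bs} i m guard x∉ unhit {a} a∈ = by-side (posF a) (sideF a ≟ τ) refl refl
      where
      open ToLeaf τ i m
      open Guard guard
      h>0 : 0 < h
      h>0 = hub>0 τ i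
      lower : ∀ {k} → k ≤ gap τ h (decode a) → suc k ≤ d a x
      lower k≤ = ≤-trans (s≤s (≤-trans k≤ (m≤n+m _ (off (decode a))))) (d-lower λ { refl → x∉ a∈ })
      root-near : d root! x ≤ suc h
      root-near = d-spine-leaf τ i m {0} h refl
      first-near : d (sp τ 1) x ≤ h
      first-near = ≤-trans (d-spine-leaf τ i m {1} (h ∸ 1) (m+[n∸m]≡n h>0)) (≤-reflexive (m+[n∸m]≡n h>0))
      far-away : h < gap τ h (decode a) → ∃[ b ] b ∈ bs × d b x < d a x
      far-away h< with base
      ... | inj₁ (r∈ , _) = root! , r∈ , ≤-trans (s≤s root-near) (lower h<)
      ... | inj₂ f∈       = sp τ 1 , f∈ , ≤-trans (s≤s (≤-trans first-near (n≤1+n h))) (lower h<)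
      at-root : posF a ≡ 0 → h ≤ gap τ h (decode a) → ∃[ b ] b ∈ bs × d b x < d a x
      at-root p≡0 h≤ with base
      ... | inj₁ (_ , r∉) = contradiction (subst (_∈ as) (posF≡0⇒root p≡0) a∈) r∉
      ... | inj₂ f∈       = sp τ 1 , f∈ , ≤-trans (s≤s first-near) (lower h≤)
      by-side : ∀ p (s? : Dec (sideF a ≡ τ)) → posF a ≡ p → gap τ h (decode a) ≡ gapAt s? p h → ∃[ b ] b ∈ bs × d b x < d a x
      by-side zero    (no _)   p≡ eq = at-root p≡ (≤-reflexive (sym eq))
      by-side zero    (yes _)  p≡ eq = at-root p≡ (≤-reflexive (sym eq))
      by-side (suc p) (no _)   p≡ eq = far-away (≤-trans (s≤s (m≤n+m h p)) (≤-reflexive (sym eq)))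
      by-side (suc p) (yes s≡) p≡ eq with h ≤? suc p
      ... | yes h≤ = far-away (≤-trans (+-cancelʳ-< h h (suc p ∸ h) below) (≤-reflexive (trans (sym (m≤n⇒∣n-m∣≡n∸m h≤)) (sym eq))))
        where
        below : h + h < suc p ∸ h + h
        below = subst₂ _<_ (cong (h +_) (+-identityʳ h)) (sym (m∸n+n≡m h≤))
                  (subst (2 * h <_) p≡ (unhit a∈ s≡ (subst (h ≤_) (sym p≡) h≤)))
      ... | no h≰ = inside (blocks a∈ (s≡ , subst (0 <_) (sym p≡) (s≤s z≤n)) (subst (_< h) (sym p≡) (≰⇒> h≰)) (hub≤P τ i))
        where
        inside : (∃[ q ] posF a < q × q ≤ h × sp τ q ∈ bs) ⊎ sp τ h ∈ as → ∃[ b ] b ∈ bs × d b x < d a x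
        inside (inj₁ (q , z<q , q≤h , q∈)) = sp τ q , q∈ , (begin-strict
          d (sp τ q) x         ≤⟨ d-spine-leaf τ i m {q} (h ∸ q) (m+[n∸m]≡n q≤h) ⟩
          suc (h ∸ q)          <⟨ s≤s (∸-monoʳ-< (subst (_< q) p≡ z<q) q≤h) ⟩
          suc (h ∸ suc p)      ≤⟨ lower (≤-reflexive (trans (sym (m≤n⇒∣m-n∣≡n∸m (<⇒≤ (≰⇒> h≰)))) (sym eq))) ⟩
          d a x                ∎)
          where open ≤-Reasoning
        -- A vertex of A on the hub itself has position exactly `h`, which `unhit` forbids.
        inside (inj₂ h∈) = contradiction (unhit h∈ side≡ (≤-reflexive (sym pos≡)))
                             (≤⇒≯ (≤-trans (≤-reflexive pos≡) (m≤m+n h _)))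
          where
          pos≡ : posF (sp τ h) ≡ h
          pos≡ = posF-sp τ (hub≤P τ i)
          side≡ : sideF (sp τ h) ≡ τ
          side≡ = subst (λ k → sideF (sp τ k) ≡ τ) (m+[n∸m]≡n h>0) (sideF-sp τ (h ∸ 1))

    guard⇒protected : ∀ {τ as bs} → τ ≢ 2F → Guard τ as bs → Protected τ as bs
    guard⇒protected τ≢2 guard i m x∉ ¬hit = guarded-leaf i m guard x∉ λ a∈ s≡ h≤ →
      ≰⇒> λ ≤2h → ¬hit (Any.map (λ { refl → τ≢2 , s≡ , h≤ , ≤2h }) a∈)

    shielded⇒protected : ∀ {as bs} → Guard 2F as bs → (∀ {a} → a ∈ as → sideF a ≢ 2F) → Protected 2F as bs
    shielded⇒protected guard off-leg i m x∉ _ = guarded-leaf i m guard x∉ λ a∈ s≡ _ → contradiction s≡ (off-leg a∈)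

    -- `V` is adjacent to every leaf of leg 2. Apart from the leaf itself, only `V` is that near.
    held⇒protected : ∀ {as bs} → sp 2F 1 ∈ bs → sp 2F 1 ∉ as → Protected 2F as bs
    held⇒protected {as} v∈ v∉ i m x∉ _ {a} a∈ = sp 2F 1 , v∈ ,
      ≤-trans (s≤s (d-spine-leaf 2F i m {1} 0 refl))
              (≤-trans (s≤s (n≢0⇒n>0 far≢0)) (d-lower λ { refl → x∉ a∈ }))
      where
      open ToLeaf 2F i m
      far≢0 : far (decode a) ≢ 0
      far≢0 eq = by-side (sideF a ≟ 2F) (m+n≡0⇒n≡0 (off (decode a)) eq)
        where
        by-side : (s? : Dec (sideF a ≡ 2F)) → gapAt s? (posF a) 1 ≡ 0 → ⊥
        by-side (no _)   gap≡0 = contradiction (trans (sym gap≡0) (+-comm (posF a) 1)) λ ()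
        by-side (yes s≡) gap≡0 = v∉ (subst (_∈ as) (trans (sym (encode-decode a)) (cong encode (trans
          (on-spine (decode a) (m+n≡0⇒m≡0 _ eq) (∣m-n∣≡0⇒m≡n gap≡0)) (cong (λ σ → spineAt σ 1) s≡)))) a∈)

  -- Counting what A can own

  module Counting (N M : ℕ) where
    open Clusters N M public

    -- Doubling a power of 3 stays below the next power.
    3^-separated : ∀ {i j} z → i < j → z ≤ 2 * 3 ^ i → ¬ 3 ^ j ≤ z
    3^-separated {i} {j} z i<j z≤ ≤z = <⇒≱ (begin-strict
      2 * 3 ^ i    <⟨ *-monoˡ-< (3 ^ i) ⦃ m^n≢0 3 i ⦄ {2} {3} ≤-refl ⟩
      3 ^ suc i    ≤⟨ ^-monoʳ-≤ 3 i<j ⟩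
      3 ^ j        ∎) (≤-trans ≤z z≤)
      where open ≤-Reasoning

    3^-unique : ∀ {i j : Fin N} z → 3 ^ toℕ i ≤ z → z ≤ 2 * 3 ^ toℕ i → 3 ^ toℕ j ≤ z → z ≤ 2 * 3 ^ toℕ j → i ≡ j
    3^-unique {i} {j} z ≤i i≤ ≤j j≤ with <-cmp (toℕ i) (toℕ j)
    ... | tri< i<j _ _ = contradiction ≤j (3^-separated z i<j i≤)
    ... | tri≈ _ i≡j _ = toℕ-injective i≡j
    ... | tri> _ _ j<i = contradiction ≤i (3^-separated z j<i j≤)

    hit-unique : ∀ {a} τ {i j} → Hit τ i a → Hit τ j a → i ≡ j
    hit-unique {a} 0F (_ , _ , ≤i , i≤) (_ , _ , ≤j , j≤) = 3^-unique (posF a) ≤i i≤ ≤j j≤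
    hit-unique {a} 1F (_ , _ , ≤i , i≤) (_ , _ , ≤j , j≤) = 3^-unique (posF a) ≤i i≤ ≤j j≤
    hit-unique     2F (2≢2 , _)         _                 = contradiction refl 2≢2

    -- `sideF` singles out one leg, and on that leg the intervals of `Hit` are disjoint.
    hits-of : ∀ a → sum (λ τ → card (λ i → hit? τ i a)) ≤ 1
    hits-of a = ≤-trans (sum-mono leg) (card-unique (sideF a ≟_) λ p q → trans (sym p) q)
      where
      on-leg : ∀ τ (s? : Dec (sideF a ≡ τ)) → card (λ i → hit? τ i a) ≤ ⟦ s? ⟧
      on-leg τ (yes _) = card-unique (λ i → hit? τ i a) (hit-unique {a} τ)
      on-leg τ (no s≢) = ≤-trans (sum-mono λ i → unhit (hit? τ i a)) (≤-reflexive (trans (sum-const N 0) (*-zeroʳ N)))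
        where
        unhit : ∀ {i} (h? : Dec (Hit τ i a)) → ⟦ h? ⟧ ≤ 0
        unhit (yes (_ , s≡ , _)) = contradiction s≡ s≢
        unhit (no _)             = z≤n
      leg : ∀ τ → card (λ i → hit? τ i a) ≤ ⟦ sideF a ≟ τ ⟧
      leg τ = on-leg τ (sideF a ≟ τ)

    hits≤length : ∀ as → sum (λ τ → sum (λ i → ⟦ anyHit? as τ i ⟧)) ≤ length as
    hits≤length []       = ≤-trans (sum-mono {3} λ τ → ≤-reflexive (trans (sum-const N 0) (*-zeroʳ N))) ≤-refl
    hits≤length (a ∷ as) = begin
      sum (λ τ → sum (λ i → ⟦ anyHit? (a ∷ as) τ i ⟧))
        ≤⟨ sum-mono (λ τ → sum-mono (λ i → ⟦⊎⟧≤ (hit? τ i a) (anyHit? as τ i))) ⟩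
      sum (λ τ → sum (λ i → ⟦ hit? τ i a ⟧ + ⟦ anyHit? as τ i ⟧))
        ≡⟨ sum-cong-≗ (λ τ → ∑-distrib-+ (λ i → ⟦ hit? τ i a ⟧) (λ i → ⟦ anyHit? as τ i ⟧)) ⟩
      sum (λ τ → card (λ i → hit? τ i a) + sum (λ i → ⟦ anyHit? as τ i ⟧))
        ≡⟨ ∑-distrib-+ (λ τ → card (λ i → hit? τ i a)) (λ τ → sum (λ i → ⟦ anyHit? as τ i ⟧)) ⟩
      sum (λ τ → card (λ i → hit? τ i a)) + sum (λ τ → sum (λ i → ⟦ anyHit? as τ i ⟧))
        ≤⟨ +-mono-≤ (hits-of a) (hits≤length as) ⟩
      suc (length as) ∎
      where open ≤-Reasoning

    -- The summands are A's claimed vertices, the root, the three spines, and `M` leaves for each of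
    -- the `N` clusters of the abandoned leg and the at most `t` clusters hit.
    bound : ℕ → ℕ
    bound t = t + (1 + (3 * P + M * (N + t)))

    -- A owns at most its own vertices, the spine, the leg u, and the clusters it hits.
    module _ (u : Fin 3) (as : List (Fin order)) where

      lost : Fin 3 → Fin N → ℕ
      lost τ i = ⟦ τ ≟ u ⟧ + ⟦ anyHit? as τ i ⟧

      weight : Node → ℕ
      weight root         = 1
      weight (spine _ _)  = 1
      weight (leaf τ i _) = lost τ i

      cluster-sum : ∀ τ → sum (λ i → sum {M} (λ _ → lost τ i)) ≡ M * (N * ⟦ τ ≟ u ⟧ + sum (λ i → ⟦ anyHit? as τ i ⟧))
      cluster-sum τ = begin
        sum (λ i → sum {M} (λ _ → lost τ i))       ≡⟨ sum-cong-≗ (λ i → sum-const M (lost τ i)) ⟩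
        sum (λ i → M * lost τ i)                   ≡⟨ *-distribˡ-sum M (lost τ) ⟨
        M * sum (lost τ)                           ≡⟨ cong (M *_) (∑-distrib-+ (λ _ → ⟦ τ ≟ u ⟧) (λ i → ⟦ anyHit? as τ i ⟧)) ⟩
        M * (sum {N} (λ _ → ⟦ τ ≟ u ⟧) + sum (λ i → ⟦ anyHit? as τ i ⟧))
          ≡⟨ cong (λ k → M * (k + sum (λ i → ⟦ anyHit? as τ i ⟧))) (sum-const N ⟦ τ ≟ u ⟧) ⟩
        M * (N * ⟦ τ ≟ u ⟧ + sum (λ i → ⟦ anyHit? as τ i ⟧)) ∎
        where open ≡-Reasoning

      weight-sum : sum (λ v → weight (decode v)) ≤ 1 + (3 * P + M * (N + length as))
      weight-sum = begin
        sum (λ v → weight (decode v))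
          ≡⟨ sum-nodes (λ v → weight (decode v)) ⟩
        weight (decode (encode root)) + sum (λ τ → sum (λ p → weight (decode (encode (spine τ p))))
                                              + sum (λ i → sum (λ m → weight (decode (encode (leaf τ i m))))))
          ≡⟨ cong₂ _+_ (cong weight (decode-encode root)) (sum-cong-≗ λ τ → cong₂ _+_
               (sum-cong-≗ λ p → cong weight (decode-encode (spine τ p)))
               (sum-cong-≗ λ i → sum-cong-≗ λ m → cong weight (decode-encode (leaf τ i m)))) ⟩
        1 + sum (λ τ → sum {P} (λ _ → 1) + sum (λ i → sum {M} (λ _ → lost τ i)))
          ≡⟨ cong suc (sum-cong-≗ λ τ → cong₂ _+_ (trans (sum-const P 1) (*-identityʳ P)) (cluster-sum τ)) ⟩
        1 + sum (λ τ → P + M * share τ)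
          ≡⟨ cong suc (trans (∑-distrib-+ {3} (λ _ → P) (λ τ → M * share τ)) (cong₂ _+_ (sum-const 3 P) (sym (*-distribˡ-sum M share)))) ⟩
        1 + (3 * P + M * sum share)
          ≡⟨ cong (λ k → 1 + (3 * P + M * k)) (trans (∑-distrib-+ (λ τ → N * ⟦ τ ≟ u ⟧) (λ τ → sum (λ i → ⟦ anyHit? as τ i ⟧)))
               (cong (_+ sum (λ τ → sum (λ i → ⟦ anyHit? as τ i ⟧))) (sym (*-distribˡ-sum {3} N (λ τ → ⟦ τ ≟ u ⟧))))) ⟩
        1 + (3 * P + M * (N * card (_≟ u) + sum (λ τ → sum (λ i → ⟦ anyHit? as τ i ⟧))))
          ≤⟨ s≤s (+-monoʳ-≤ (3 * P) (*-monoʳ-≤ M (+-mono-≤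
               (≤-trans (*-monoʳ-≤ N (card-unique (_≟ u) λ p q → trans p (sym q))) (≤-reflexive (*-identityʳ N))) (hits≤length as)))) ⟩
        1 + (3 * P + M * (N + length as)) ∎
        where
        open ≤-Reasoning
        share : Fin 3 → ℕ
        share τ = N * ⟦ τ ≟ u ⟧ + sum (λ i → ⟦ anyHit? as τ i ⟧)

      score-bound : ∀ {bs b} → b ∈ bs → (∀ {τ} → τ ≢ u → Protected τ as bs) → score2 tree as bs ≤ 2 * bound (length as)
      score-bound {bs} b∈ protected = ≤-trans (score-upper as bs cost cover) (*-monoʳ-≤ 2 (begin
        sum cost                                                     ≡⟨ ∑-distrib-+ (λ v → ⟦ v ∈? as ⟧) (λ v → weight (decode v)) ⟩
        sum (λ v → ⟦ v ∈? as ⟧) + sum (λ v → weight (decode v))      ≤⟨ +-mono-≤ (card-∈≤length as) weight-sum ⟩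
        bound (length as)                                            ∎))
        where
        open ≤-Reasoning
        cost : Fin order → ℕ
        cost v = ⟦ v ∈? as ⟧ + weight (decode v)
        cover-leaf : ∀ τ i m {e} → (v∈? : Dec (lf τ i m ∈ as)) (u? : Dec (τ ≡ u)) (hit : Dec (Any (Hit τ i) as)) →
                     e ≡ ⟦ v∈? ⟧ + (⟦ u? ⟧ + ⟦ hit ⟧) → Owns bs as (lf τ i m) ⊎ 1 ≤ e
        cover-leaf τ i m (yes _) _       _       refl = inj₂ (s≤s z≤n)
        cover-leaf τ i m (no _)  (yes _) _       refl = inj₂ (s≤s z≤n)
        cover-leaf τ i m (no _)  (no _)  (yes _) refl = inj₂ ≤-refl
        cover-leaf τ i m (no v∉) (no ≢u) (no ¬h) _    = inj₁ (Beats⇒< b∈ (protected ≢u i m v∉ ¬h))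
        by-node : ∀ w → Owns bs as (encode w) ⊎ 1 ≤ ⟦ encode w ∈? as ⟧ + weight w
        by-node root         = inj₂ (m≤n+m 1 _)
        by-node (spine _ _)  = inj₂ (m≤n+m 1 _)
        by-node (leaf τ i m) = cover-leaf τ i m (lf τ i m ∈? as) (τ ≟ u) (anyHit? as τ i) refl
        cover : ∀ v → Owns bs as v ⊎ 1 ≤ cost v
        cover v = subst (λ w → Owns bs as w ⊎ 1 ≤ ⟦ w ∈? as ⟧ + weight (decode v)) (encode-decode v) (by-node (decode v))

  -- The strategy of B on the tripod

  module Strategy (N M : ℕ) where
    open Counting N M public

    Positions : Set
    Positions = List (Fin order)

    V : Fin order
    V = sp 2F 1

    record Reply (Q : Fin order → Set) (as bs : Positions) : Set where
      constructor reply
      field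
        {vertex} : Fin order
        ∉as      : vertex ∉ as
        ∉bs      : vertex ∉ bs
        property : Q vertex

    spare-reply : ∀ {as bs} {Q : Fin order → Set} → length as + length bs < order → (∀ b → Q b) → Reply Q as bs
    spare-reply {as} {bs} room q with ∃∉ (as ++ bs) (≤-trans (≤-reflexive (cong suc (length-++ as))) room)
    ... | b , b∉ = reply (b∉ ∘ ∈-++⁺ˡ) (b∉ ∘ ∈-++⁺ʳ as) (q b)

    -- B claims the first vertex beyond z not claimed by A.
    block : ∀ {as bs} τ z → length as + length bs < order → Reply (λ b → Blocked τ z as (b ∷ bs)) as bs
    block {as} {bs} τ z room = go (P ∸ z) z (m≤n+m∸n P z)
      where
      go : ∀ k z → P ≤ z + k → Reply (λ b → Blocked τ z as (b ∷ bs)) as bs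
      go zero z P≤ = spare-reply room λ b z<p p≤P →
        contradiction (≤-trans p≤P (≤-trans P≤ (≤-reflexive (+-identityʳ z)))) (<⇒≱ z<p)
      go (suc k) z P≤ with sp τ (suc z) ∈? as | sp τ (suc z) ∈? bs
      ... | yes ∈as | _ = extend (go k (suc z) (≤-trans P≤ (≤-reflexive (+-suc z k))))
        where
        extend : Reply (λ b → Blocked τ (suc z) as (b ∷ bs)) as bs → Reply (λ b → Blocked τ z as (b ∷ bs)) as bs
        extend (reply ∉as ∉bs blocked) = reply ∉as ∉bs λ {p} z<p p≤P → case p z<p p≤P (suc z ℕ.≟ p)
          where
          case : ∀ p → z < p → p ≤ P → Dec (suc z ≡ p) → _
          case p z<p p≤P (yes refl) = inj₂ ∈as
          case p z<p p≤P (no ≢p) with blocked (≤∧≢⇒< z<p ≢p) p≤P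
          ... | inj₁ (q , sz<q , q≤p , q∈) = inj₁ (q , <⇒≤ sz<q , q≤p , q∈)
          ... | inj₂ p∈                    = inj₂ p∈
      -- B owns the next vertex already, so any free vertex completes the reply.
      ... | no _    | yes ∈bs = spare-reply room λ b z<p _ → inj₁ (suc z , ≤-refl , z<p , there ∈bs)
      ... | no ∉as  | no ∉bs  = reply ∉as ∉bs λ z<p _ → inj₁ (suc z , ≤-refl , z<p , here refl)

    claim : ∀ {as bs} v → v ∉ as → length as + length bs < order → Reply (λ b → v ∈ b ∷ bs) as bs
    claim {as} {bs} v v∉as room with v ∈? bs
    ... | yes v∈bs = spare-reply room λ _ → there v∈bs
    ... | no  v∉bs = reply v∉as v∉bs (here refl)

    Blocked-mono : ∀ {τ z as bs a b} → Blocked τ z as bs → Blocked τ z (a ∷ as) (b ∷ bs)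
    Blocked-mono blocked z<p p≤P with blocked z<p p≤P
    ... | inj₁ (q , z<q , q≤p , q∈) = inj₁ (q , z<q , q≤p , there q∈)
    ... | inj₂ p∈                   = inj₂ (there p∈)

    ∉-∷ : ∀ {v a : Fin order} {as bs} → v ∉ as → v ∈ bs → a ∉ bs → v ∉ a ∷ as
    ∉-∷ v∉ v∈bs a∉bs (here refl) = a∉bs v∈bs
    ∉-∷ v∉ v∈bs a∉bs (there v∈)  = v∉ v∈

    Guard-extend : ∀ {τ as bs a b} → a ∉ bs → (On τ a → Blocked τ (posF a) (a ∷ as) (b ∷ bs)) →
                   Guard τ as bs → Guard τ (a ∷ as) (b ∷ bs)
    Guard-extend {τ} {as} {bs} {a} {b} a∉bs new guard = record { base = base′ (Guard.base guard) ; blocks = blocks′ }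
      where
      base′ : (root! ∈ bs × root! ∉ as) ⊎ sp τ 1 ∈ bs → (root! ∈ b ∷ bs × root! ∉ a ∷ as) ⊎ sp τ 1 ∈ b ∷ bs
      base′ (inj₁ (r∈ , r∉)) = inj₁ (there r∈ , ∉-∷ r∉ r∈ a∉bs)
      base′ (inj₂ f∈)        = inj₂ (there f∈)
      blocks′ : ∀ {a′} → a′ ∈ a ∷ as → On τ a′ → Blocked τ (posF a′) (a ∷ as) (b ∷ bs)
      blocks′ (here refl) on = new on
      blocks′ (there a′∈) on = Blocked-mono (Guard.blocks guard a′∈ on)

    -- On legs 0 and 1 later vertices of A have to be blocked one by one; on leg 2 the possession of
    -- `V` is enough for good.
    data Secured (τ : Fin 3) (as bs : Positions) : Set where
      guarded : τ ≢ 2F → Guard τ as bs → Secured τ as bs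
      held    : τ ≡ 2F → V ∈ bs → V ∉ as → Secured τ as bs

    secured⇒protected : ∀ {τ as bs} → Secured τ as bs → Protected τ as bs
    secured⇒protected (guarded τ≢2 guard) = guard⇒protected τ≢2 guard
    secured⇒protected (held refl v∈ v∉)   = held⇒protected v∈ v∉

    -- `a` lies on one leg only, so a single block on that leg maintains every secured leg at once.
    Secured-extend : ∀ {τ as bs a b} → a ∉ bs → Blocked (sideF a) (posF a) (a ∷ as) (b ∷ bs) →
                     Secured τ as bs → Secured τ (a ∷ as) (b ∷ bs)
    Secured-extend a∉bs blocked (guarded τ≢2 guard) = guarded τ≢2 (Guard-extend a∉bs (λ { (refl , _) → blocked }) guard)
    Secured-extend a∉bs blocked (held τ≡2 v∈ v∉)    = held τ≡2 (there v∈) (∉-∷ v∉ v∈ a∉bs)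

    -- Booleans index the two legs with spread-out clusters, so that `not` exchanges them.
    leg : Bool → Fin 3
    leg false = 0F
    leg true  = 1F

    leg≢2 : ∀ k → leg k ≢ 2F
    leg≢2 false ()
    leg≢2 true  ()

    leg-cases : ∀ k τ → τ ≡ leg k ⊎ τ ≡ leg (not k) ⊎ τ ≡ 2F
    leg-cases false 0F = inj₁ refl
    leg-cases false 1F = inj₂ (inj₁ refl)
    leg-cases true  0F = inj₂ (inj₁ refl)
    leg-cases true  1F = inj₁ refl
    leg-cases _     2F = inj₂ (inj₂ refl)

    leg-not≢ : ∀ k → leg (not k) ≢ leg k
    leg-not≢ false ()
    leg-not≢ true  ()

    data State (as bs : Positions) : Set where
      settled : ∀ u → (∀ {τ} → τ ≢ u → Secured τ as bs) → State as bs
      -- B holds the root and guards one leg; the vertices of A on the other one all have position z,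
      -- and B will either block them or take V, whichever A leaves.
      pending : ∀ k z → root! ∈ bs → root! ∉ as → Guard (leg k) as bs → (∀ {a} → a ∈ as → sideF a ≢ 2F) →
                (∀ {a} → a ∈ as → On (leg (not k)) a → posF a ≡ z) → State as bs

    secured-2F-and-leg : ∀ k {as bs} → Guard (leg k) as bs → V ∈ bs → V ∉ as → State as bs
    secured-2F-and-leg k {as} {bs} guard v∈ v∉ = settled (leg (not k)) secured
      where
      secured : ∀ {τ} → τ ≢ leg (not k) → Secured τ as bs
      secured {τ} τ≢ with leg-cases k τ
      ... | inj₁ refl        = guarded (leg≢2 k) guard
      ... | inj₂ (inj₁ refl) = contradiction refl τ≢
      ... | inj₂ (inj₂ τ≡2)  = held τ≡2 v∈ v∉

    secured-legs : ∀ k {as bs} → Guard (leg k) as bs → Guard (leg (not k)) as bs → State as bs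
    secured-legs k {as} {bs} guard guard′ = settled 2F secured
      where
      secured : ∀ {τ} → τ ≢ 2F → Secured τ as bs
      secured {τ} τ≢2 with leg-cases k τ
      ... | inj₁ refl        = guarded τ≢2 guard
      ... | inj₂ (inj₁ refl) = guarded τ≢2 guard′
      ... | inj₂ (inj₂ refl) = contradiction refl τ≢2

    sideF-V : sideF V ≡ 2F
    sideF-V = sideF-sp 2F 0

    respond : ∀ {as bs a} → State as bs → a ∉ bs → length (a ∷ as) + length bs < order →
           Reply (λ b → State (a ∷ as) (b ∷ bs)) (a ∷ as) bs
    respond {as} {bs} {a} (settled u secured) a∉bs room with block {a ∷ as} {bs} (sideF a) (posF a) room
    ... | reply ∉as ∉bs blocked = reply ∉as ∉bs (settled u (Secured-extend a∉bs blocked ∘ secured))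
    respond {as} {bs} {a} (pending k z r∈ r∉ guard ≢2 at-z) a∉bs room with a ≟ V
    -- Leg 2 is given up. All vertices of A on the unguarded leg have position `z`, so one block
    -- beyond `z` guards it.
    ... | yes refl = take-V (block {V ∷ as} {bs} (leg (not k)) z room)
      where
      take-V : Reply (λ b → Blocked (leg (not k)) z (V ∷ as) (b ∷ bs)) (V ∷ as) bs →
               Reply (λ b → State (V ∷ as) (b ∷ bs)) (V ∷ as) bs
      take-V (reply ∉as ∉bs blocked) = reply ∉as ∉bs (secured-legs k
        (Guard-extend a∉bs (λ { (s≡ , _) → contradiction (trans (sym s≡) sideF-V) (leg≢2 k) }) guard)
        record { base = inj₁ (there r∈ , ∉-∷ r∉ r∈ a∉bs) ; blocks = λ where
          (here refl) (s≡ , _) → contradiction (trans (sym s≡) sideF-V) (leg≢2 (not k))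
          (there a′∈) on {p} → subst (λ z → Blocked (leg (not k)) z _ _) (sym (at-z a′∈ on)) blocked {p} })
    ... | no a≢V with sideF a ≟ leg k
    -- The new vertex is blocked on the guarded leg, and the choice between the other two legs stays
    -- open.
    ...   | yes s≡ = on-guarded (block {a ∷ as} {bs} (leg k) (posF a) room)
      where
      on-guarded : Reply (λ b → Blocked (leg k) (posF a) (a ∷ as) (b ∷ bs)) (a ∷ as) bs →
                   Reply (λ b → State (a ∷ as) (b ∷ bs)) (a ∷ as) bs
      on-guarded (reply ∉as ∉bs blocked) = reply ∉as ∉bs (pending k z (there r∈) (∉-∷ r∉ r∈ a∉bs)
        (Guard-extend a∉bs (λ _ {p} → blocked {p}) guard)
        (λ { (here refl) s≡2 → leg≢2 k (trans (sym s≡) s≡2) ; (there a′∈) → ≢2 a′∈ })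
        (λ { (here refl) (s≡′ , _) → contradiction (trans (sym s≡′) s≡) (leg-not≢ k) ; (there a′∈) → at-z a′∈ }))
    -- A has left `V` alone; B secures it and gives up `leg (not k)`.
    ...   | no s≢ = off-guarded (claim {a ∷ as} {bs} V V∉ room)
      where
      V∉ : V ∉ a ∷ as
      V∉ (here V≡a) = a≢V (sym V≡a)
      V∉ (there V∈) = ≢2 V∈ sideF-V
      off-guarded : Reply (λ b → V ∈ b ∷ bs) (a ∷ as) bs → Reply (λ b → State (a ∷ as) (b ∷ bs)) (a ∷ as) bs
      off-guarded (reply ∉as ∉bs V∈) = reply ∉as ∉bs (secured-2F-and-leg k
        (Guard-extend a∉bs (λ { (s≡ , _) → contradiction s≡ s≢ }) guard) V∈ V∉)

    final-score : ∀ {as bs b} → b ∈ bs → State as bs → score2 tree as bs ≤ 2 * bound (length as)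
    final-score {as} b∈ (settled u secured) = score-bound u as b∈ (secured⇒protected ∘ secured)
    -- The choice may still be open at the end. Then A has nothing on leg 2, and the root alone
    -- protects it.
    final-score {as} {bs} b∈ (pending k z r∈ r∉ guard ≢2 at-z) = score-bound (leg (not k)) as b∈ protected
      where
      protected : ∀ {τ} → τ ≢ leg (not k) → Protected τ as bs
      protected {τ} τ≢ with leg-cases k τ
      ... | inj₁ refl        = guard⇒protected (leg≢2 k) guard
      ... | inj₂ (inj₁ refl) = contradiction refl τ≢
      ... | inj₂ (inj₂ refl) = shielded⇒protected
        record { base = inj₁ (r∈ , r∉) ; blocks = λ a∈ on → contradiction (proj₁ on) (≢2 a∈) } ≢2

    replies⇒≤ : ∀ {r as bs K} →
      (∀ {a} → a ∉ as → a ∉ bs → Reply (λ b → gameA tree r (a ∷ as) (b ∷ bs) ≤ K) (a ∷ as) bs) →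
      gameA tree (suc r) as bs ≤ K
    replies⇒≤ {r} {as} {bs} replies = max-all (unclaimed tree as bs) λ {a} a∈ →
      let a∉as , a∉bs               = unclaimed⁻ {as} {bs} a∈
          reply {b} b∉as b∉bs value = replies a∉as a∉bs
      in ≤-trans (min-≤ (unclaimed⁺ {a ∷ as} {bs} {b} b∉as b∉bs)) value

    module _ {t : ℕ} (2t≤order : 2 * t ≤ order) where

      room : ∀ {r la lb} → la + suc r ≡ t → lb + suc r ≡ t → suc la + lb < order
      room {r} {la} {lb} la≡ lb≡ = ≤-trans (begin
        suc (suc la + lb)         ≡⟨ +-suc (suc la) lb ⟨
        suc la + suc lb           ≤⟨ +-mono-≤ (taken la≡) (taken lb≡) ⟩
        t + t                     ≡⟨ cong (t +_) (+-identityʳ t) ⟨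
        2 * t                     ∎) 2t≤order
        where
        open ≤-Reasoning
        taken : ∀ {l} → l + suc r ≡ t → suc l ≤ t
        taken {l} eq = ≤-trans (≤-trans (m≤m+n (suc l) r) (≤-reflexive (sym (+-suc l r)))) (≤-reflexive eq)

      play : ∀ r {as bs b} → b ∈ bs → length as + r ≡ t → length bs + r ≡ t → State as bs →
             gameA tree r as bs ≤ 2 * bound t
      play zero {as} {bs} b∈ la≡ lb≡ state =
        subst (λ l → score2 tree as bs ≤ 2 * bound l) (trans (sym (+-identityʳ (length as))) la≡) (final-score b∈ state)
      play (suc r) {as} {bs} b∈ la≡ lb≡ state = replies⇒≤ {r} {as} {bs} λ _ a∉bs → continue (respond state a∉bs (room la≡ lb≡))
        where
        continue : ∀ {a} → Reply (λ b → State (a ∷ as) (b ∷ bs)) (a ∷ as) bs →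
                   Reply (λ b → gameA tree r (a ∷ as) (b ∷ bs) ≤ 2 * bound t) (a ∷ as) bs
        continue (reply ∉as ∉bs state′) = reply ∉as ∉bs
          (play r (there b∈) (trans (sym (+-suc (length as) r)) la≡) (trans (sym (+-suc (length bs) r)) lb≡) state′)

      unopposed : ∀ {τ as b} → sp τ 1 ∈ b ∷ [] ⊎ (root! ∈ b ∷ [] × root! ∉ as) → (∀ {a} → a ∈ as → ¬ On τ a) → Guard τ as (b ∷ [])
      unopposed base off = record { base = swap base ; blocks = λ a∈ on → contradiction on (off a∈) }

      -- Two rounds are matched off because `elsewhere` spends B's first two moves on `V` and the
      -- start of a leg.
      game-value : 2 ≤ t → gameA tree t [] [] ≤ 2 * bound t
      game-value (s≤s {n = suc r} (s≤s _)) = replies⇒≤ {suc r} {[]} {[]} λ {a} _ _ → opening a (sideF a) refl (a ≟ V) (posF a ℕ.≟ 0)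
        where
        Opening : Fin order → Set
        Opening a = Reply (λ b → gameA tree (suc r) (a ∷ []) (b ∷ []) ≤ 2 * bound t) (a ∷ []) []

        take-root : ∀ {a} → posF a ≢ 0 → State (a ∷ []) (root! ∷ []) → Opening a
        take-root {a} p≢0 state = reply (λ { (here refl) → p≢0 (posF-sp 0F z≤n) }) (λ ())
          (play (suc r) (here refl) refl refl state)

        on-leg : ∀ {a} k → sideF a ≡ leg (not k) → posF a ≢ 0 → Opening a
        on-leg {a} k s≡ p≢0 = take-root p≢0 (pending k (posF a) (here refl) root∉
          (unopposed (inj₂ (here refl , root∉)) λ { (here refl) (s≡′ , _) → leg-not≢ k (trans (sym s≡) s≡′) })
          (λ { (here refl) s≡2 → leg≢2 (not k) (trans (sym s≡) s≡2) }) (λ { (here refl) _ → refl }))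
          where
          root∉ : root! ∉ a ∷ []
          root∉ (here refl) = p≢0 (posF-sp 0F z≤n)

        elsewhere : ∀ {a} → a ≢ V → (∀ k → ¬ On (leg k) a) → Opening a
        elsewhere {a} a≢V off = reply (λ { (here V≡a) → a≢V (sym V≡a) }) (λ ())
          (replies⇒≤ {r} {a ∷ []} {V ∷ []} λ {a′} _ a′∉ → second a′∉ (sideF a′ ≟ 0F))
          where
          take-leg : ∀ {a′} k → a′ ∉ V ∷ [] → sideF a′ ≢ leg k →
                     Reply (λ b → gameA tree r (a′ ∷ a ∷ []) (b ∷ V ∷ []) ≤ 2 * bound t) (a′ ∷ a ∷ []) (V ∷ [])
          take-leg {a′} k a′∉ s≢ = reply
            (λ { (here refl) → s≢ (sideF-sp (leg k) 0)
               ; (there (here refl)) → off k (sideF-sp (leg k) 0 , ≤-reflexive (sym (posF-sp (leg k) {1} (s≤s z≤n)))) })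
            (λ { (here eq) → leg≢2 k (trans (sym (sideF-sp (leg k) 0)) (trans (cong sideF eq) sideF-V)) })
            (play r (here refl) refl refl (secured-2F-and-leg k
              record { base = inj₂ (here refl)
                     ; blocks = λ { (here refl) (s≡ , _) → contradiction s≡ s≢
                                  ; (there (here refl)) on → contradiction on (off k) } }
              (there (here refl))
              (λ { (here V≡a′) → a′∉ (here (sym V≡a′)) ; (there (here V≡a)) → a≢V (sym V≡a) })))
          -- `a` misses both leg 0 and leg 1 and `a′` misses at least one of them, so B finds the
          -- start of an unopposed leg free.
          second : ∀ {a′} → a′ ∉ V ∷ [] → Dec (sideF a′ ≡ 0F) →
                   Reply (λ b → gameA tree r (a′ ∷ a ∷ []) (b ∷ V ∷ []) ≤ 2 * bound t) (a′ ∷ a ∷ []) (V ∷ [])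
          second a′∉ (yes s≡0) = take-leg true a′∉ λ s≡1 → contradiction (trans (sym s≡0) s≡1) λ ()
          second a′∉ (no s≢0)  = take-leg false a′∉ s≢0

        opening : ∀ a τ → sideF a ≡ τ → Dec (a ≡ V) → Dec (posF a ≡ 0) → Opening a
        opening a τ s≡ (yes refl) _ = take-root V≢root (secured-legs false (off-leg false) (off-leg true))
          where
          V≢root : posF V ≢ 0
          V≢root eq = contradiction (trans (sym (posF-sp 2F {1} (s≤s z≤n))) eq) λ ()
          off-leg : ∀ k → Guard (leg k) (V ∷ []) (root! ∷ [])
          off-leg k = unopposed (inj₂ (here refl , λ { (here r≡V) → V≢root (trans (cong posF (sym r≡V)) (posF-sp 0F z≤n)) }))
            λ { (here refl) (s≡ , _) → leg≢2 k (trans (sym s≡) sideF-V) }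
        opening a τ  s≡ (no a≢V) (yes p≡0) = elsewhere a≢V λ { _ (_ , 0<p) → <-irrefl (sym p≡0) 0<p }
        opening a 0F s≡ (no a≢V) (no p≢0)  = on-leg true s≡ p≢0
        opening a 1F s≡ (no a≢V) (no p≢0)  = on-leg false s≡ p≢0
        opening a 2F s≡ (no a≢V) (no p≢0)  = elsewhere a≢V λ { k (s≡′ , _) → leg≢2 k (trans (sym s≡′) s≡) }

open Combinatorics using (module TwoRounds; module Strategy)

-- Passage to rational ratios and choice of parameters

open import Data.Integer using (+_)
import Data.Integer as ℤ
import Data.Integer.Properties as ℤ
open import Data.Rational using (ℚ; _/_; _<_; _+_; 0ℚ; mkℚ)
import Data.Rational as ℚ
open import Data.Rational.Properties using (toℚᵘ-cancel-<; toℚᵘ-fromℚᵘ; toℚᵘ-homo-+)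
open import Data.Rational.Unnormalised using (mkℚᵘ; *<*)
open import Data.Rational.Unnormalised.Properties using (≃-sym) renaming (<-respˡ-≃ to <ᵘ-respˡ-≃; <-respʳ-≃ to <ᵘ-respʳ-≃)

-- The fractions are compared unnormalised, since `_/_` cancels common factors; `win` is then the
-- cross-multiplied inequality.
third<VR : ∀ {n} (T : Graph n) → 0 ℕ.< n → 2 * n ℕ.< 3 * gameA T 2 [] [] → (+ 1 / 3) < VR T 2
third<VR {suc m} T _ win = toℚᵘ-cancel-< (<ᵘ-respʳ-≃ (≃-sym (toℚᵘ-fromℚᵘ (mkℚᵘ (+ s) _))) (*<* (begin-strict
  + 1 ℤ.* + (2 * suc m)    ≡⟨ ℤ.*-identityˡ _ ⟩
  + (2 * suc m)            <⟨ ℤ.+<+ win ⟩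
  + (3 * s)                ≡⟨ cong +_ (*-comm 3 s) ⟩
  + (s * 3)                ≡⟨ ℤ.pos-* s 3 ⟩
  + s ℤ.* + 3              ∎)))
  where
  open ℤ.≤-Reasoning
  s : ℕ
  s = gameA T 2 [] []

-- Here ε is `suc k` over `suc e`, and 1/3 + ε is written over the denominator `3 * suc e`.
VR<third+ε : ∀ {n} (T : Graph n) t k e .(c : Coprime (suc k) (suc e)) → 0 ℕ.< n →
  gameA T t [] [] * (3 * suc e) ℕ.< (suc e ℕ.+ suc k * 3) * (2 * n) → VR T t < (+ 1 / 3) + mkℚ (+ suc k) e c
VR<third+ε {suc m} T t k e c _ bound = toℚᵘ-cancel-< (<ᵘ-respˡ-≃ (≃-sym (toℚᵘ-fromℚᵘ (mkℚᵘ (+ s) _)))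
  (<ᵘ-respʳ-≃ (≃-sym (toℚᵘ-homo-+ (+ 1 / 3) (mkℚ (+ suc k) e c))) (*<* (begin-strict
  + s ℤ.* + (3 * suc e)                                    ≡⟨ ℤ.pos-* s (3 * suc e) ⟨
  + (s * (3 * suc e))                                      <⟨ ℤ.+<+ bound ⟩
  + ((suc e ℕ.+ suc k * 3) * (2 * suc m))                  ≡⟨ ℤ.pos-* (suc e ℕ.+ suc k * 3) (2 * suc m) ⟩
  + (suc e ℕ.+ suc k * 3) ℤ.* + (2 * suc m)                ≡⟨ cong (ℤ._* + (2 * suc m)) (cong₂ ℤ._+_ (ℤ.*-identityˡ (+ suc e)) (ℤ.pos-* (suc k) 3)) ⟨
  (+ 1 ℤ.* + suc e ℤ.+ + suc k ℤ.* + 3) ℤ.* + (2 * suc m)  ∎))))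
  where
  open ℤ.≤-Reasoning
  s : ℕ
  s = gameA T t [] []

module Parameters (t e : ℕ) where

  -- With `q` the denominator of ε, `N = q * t` makes the `t` hit clusters a fraction 1/q of a leg.
  -- `M` equals all that `bound t` charges besides clusters, so this weighs as much as one further
  -- cluster.
  q N M : ℕ
  q = suc e
  N = q * t
  M = t ℕ.+ (1 ℕ.+ 3 * suc (3 ℕ.^ N))

  open Strategy N M public using (order; bound; P; tree; isTree; game-value)

  3NM≤order : 3 * (N * M) ℕ.< order
  3NM≤order = s≤s (*-monoʳ-≤ 3 (m≤n+m (N * M) P))

  q≤N : 2 ≤ t → q ≤ N
  q≤N 2≤t = m≤m*n q t ⦃ ℕ.>-nonZero (≤-trans (s≤s z≤n) 2≤t) ⦄

  2t≤order : 2 ≤ t → 2 * t ≤ order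
  2t≤order 2≤t = begin
    2 * t          ≤⟨ *-mono-≤ (n≤1+n 2) (m≤m+n t _) ⟩
    3 * M          ≤⟨ *-monoʳ-≤ 3 (m≤n*m M N ⦃ ℕ.>-nonZero (≤-trans (s≤s z≤n) (q≤N 2≤t)) ⦄) ⟩
    3 * (N * M)    ≤⟨ <⇒≤ 3NM≤order ⟩
    order          ∎
    where open ≤-Reasoning

  bound-expand : ∀ a p m q t → (a ℕ.+ (1 ℕ.+ (p ℕ.+ m * (q * t ℕ.+ a)))) * (3 * q) ≡
                 (a ℕ.+ (1 ℕ.+ p)) * (3 * q) ℕ.+ (q * (3 * (q * t * m)) ℕ.+ 3 * (q * a * m))
  bound-expand = solve-∀

  bound-small : ∀ k → 2 ≤ t → bound t * (3 * q) ℕ.< (q ℕ.+ suc k * 3) * order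
  bound-small k 2≤t = begin-strict
    -- The expansion is taken at `a = t` and `p = 3 * P`, where `a + (1 + p)` is `M`.
    bound t * (3 * q)                                              ≡⟨ bound-expand t (3 * P) M q t ⟩
    M * (3 * q) ℕ.+ (q * (3 * (N * M)) ℕ.+ 3 * (N * M))            ≤⟨ +-monoˡ-≤ _ (*-monoʳ-≤ M (*-monoʳ-≤ 3 (q≤N 2≤t))) ⟩
    M * (3 * N) ℕ.+ (q * (3 * (N * M)) ℕ.+ 3 * (N * M))            ≤⟨ collect q N M ⟩
    (q ℕ.+ 3) * (3 * (N * M))                                      <⟨ *-monoʳ-< (q ℕ.+ 3) 3NM≤order ⟩
    -- The numerator of ε is at least 1, so a surplus of 1/q over 1/3 is within the allowance.
    (q ℕ.+ 3) * order                                              ≤⟨ *-monoˡ-≤ order (+-monoʳ-≤ q (*-monoˡ-≤ 3 {1} {suc k} (s≤s z≤n))) ⟩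
    (q ℕ.+ suc k * 3) * order                                      ∎
    where
    open ≤-Reasoning
    regroup : ∀ q N M → (q ℕ.+ 3) * (3 * (N * M)) ≡ (M * (3 * N) ℕ.+ (q * (3 * (N * M)) ℕ.+ 3 * (N * M))) ℕ.+ 3 * (N * M)
    regroup = solve-∀
    collect : ∀ q N M → M * (3 * N) ℕ.+ (q * (3 * (N * M)) ℕ.+ 3 * (N * M)) ≤ (q ℕ.+ 3) * (3 * (N * M))
    collect q N M = ≤-trans (m≤m+n _ (3 * (N * M))) (≤-reflexive (sym (regroup q N M)))

  value-small : ∀ k → 2 ≤ t → gameA tree t [] [] * (3 * q) ℕ.< (q ℕ.+ suc k * 3) * (2 * order)
  value-small k 2≤t = begin-strict
    gameA tree t [] [] * (3 * q)          ≤⟨ *-monoˡ-≤ (3 * q) (game-value {t} (2t≤order 2≤t) 2≤t) ⟩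
    2 * bound t * (3 * q)                 ≡⟨ *-assoc 2 (bound t) (3 * q) ⟩
    2 * (bound t * (3 * q))               <⟨ *-monoʳ-< 2 (bound-small k 2≤t) ⟩
    2 * ((q ℕ.+ suc k * 3) * order)       ≡⟨ swap-2 (q ℕ.+ suc k * 3) order ⟩
    (q ℕ.+ suc k * 3) * (2 * order)       ∎
    where
    open ≤-Reasoning
    swap-2 : ∀ a b → 2 * (a * b) ≡ a * (2 * b)
    swap-2 = solve-∀

theorem4 : ((n : ℕ) (T : Graph n) → IsTree T → 4 ≤ n → (+ 1 / 3) < VR T 2)
    × ((ε : ℚ) → 0ℚ < ε → (t : ℕ) → 2 ≤ t →
    Σ ℕ λ n → Σ (Graph n) λ T → IsTree T × (2 * t ≤ n) × (VR T t < (+ 1 / 3) + ε))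
theorem4 = lower , upper
  where
  lower : (n : ℕ) (T : Graph n) → IsTree T → 4 ≤ n → (+ 1 / 3) < VR T 2
  lower n T isTree 4≤n = third<VR T (≤-trans (s≤s z≤n) 4≤n) (TwoRounds.two-rounds T isTree 4≤n)
  upper : (ε : ℚ) → 0ℚ < ε → (t : ℕ) → 2 ≤ t →
          Σ ℕ λ n → Σ (Graph n) λ T → IsTree T × (2 * t ≤ n) × (VR T t < (+ 1 / 3) + ε)
  upper (mkℚ (+ suc k) e c) 0<ε t 2≤t =
    order , tree , isTree , 2t≤order 2≤t , VR<third+ε tree t k e c (s≤s z≤n) (value-small k 2≤t)
    where open Parameters t e
  upper (mkℚ (+ zero) e _)      (ℚ.*<* lt) t 2≤t = ⊥-elim (ℤ.<-irrefl refl lt)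
  upper (mkℚ (ℤ.-[1+ k ]) e _) (ℚ.*<* ()) t 2≤t
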